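{- Let $n\geq 1$ and let $\sigma,\sigma'$ be two permutations of $\{1,\dots,n\}$, considered as spindle-permutations. Then $\sigma$ and $\sigma'$ define the same switching class (that is, their linking matrices $X(\sigma)$ and $X(\sigma')$ are switching-equivalent) if and only if $\sigma$ and $\sigma'$ are spindle-equivalent.
   Context: A spindle-permutation is a permutation $\sigma$ of $\{1,\dots,n\}$. (It encodes a spindle, i.e. a configuration of $n$ pairwise skew lines in $\mathbb{R}^3$ all intersecting an auxiliary oriented line, its axis.) Its linking matrix is the symmetric $n\times n$ matrix $X(\sigma)$ with coefficients $$x_{i,j}=\mathrm{sign}\big((i-j)(\sigma(i)-\sigma(j))\big),$$ where $\mathrm{sign}(0)=0$ and $\mathrm{sign}(x)=x/|x|$ for $x\neq 0$. Two symmetric $n\times n$ matrices $X,Y$ with zero diagonal and off-diagonal coefficients in $\{\pm1\}$ are switching-equivalent if $Y=D\,P^t\,X\,P\,D$ for some permutation matrix $P$ and some diagonal matrix $D$ with diagonal entries in $\{\pm 1\}$. A switching class is an equivalence class for this relation. The switching class defined by $\sigma$ is the class of $X(\sigma)$. Spindle-equivalence is the equivalence relation on permutations of $\{1,\dots,n\}$ generated by the following three moves, where $[1,k]=\{1,\dots,k\}$: (1) (Circular move) $\sigma\sim\mu$ if there are integers $0\leq s,t<n$ such that $\mu(i)=\big(s+\sigma((i+t)\bmod n)\big)\bmod n$ for all $i$, where all integers are taken modulo $n$ with representatives in $\{1,\dots,n\}$. (2) (Vertical reflection of a block) $\sigma\sim\mu$ if there is an integer $1\leq k\leq n$ with $\sigma([1,k])=[1,k]$,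 $\mu(i)=k+1-\sigma(k+1-i)$ for $i\leq k$, and $\mu(i)=\sigma(i)$ for $i>k$. (3) (Horizontal reflection of a block) $\sigma\sim\mu$ if there is an integer $1<k\leq n$ with $\sigma([1,k])=[1,k]$, $\mu(i)=\sigma^{ -1}(i)$ for $i\leq k$, and $\mu(i)=\sigma(i)$ for $i>k$. -}

module Defs where

open import Algebra.Properties.Semiring.Sum using (sum)
open import Data.Bool.Base using (if_then_else_)
open import Data.Fin.Base using (Fin; toℕ)
open import Data.Fin.Permutation using (Permutation′; _⟨$⟩ʳ_; _⟨$⟩ˡ_)
open import Data.Fin.Properties using (_≟_)
open import Data.Integer.Base using (ℤ; +_; +0; +[1+_]; -[1+_]; 0ℤ; 1ℤ; -1ℤ; _-_; _*_)
open import Data.Integer.Properties using (+-*-semiring)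
open import Data.Nat.Base as ℕ using (ℕ; suc; pred; NonZero; _≤_; _<_; _∸_)
open import Data.Nat.DivMod using (_mod_)
open import Data.Product.Base using (_×_; ∃; ∃₂)
open import Data.Sum.Base using (_⊎_)
open import Function.Bundles using (_⇔_)
open import Level using (0ℓ)
open import Relation.Binary.Core using (Rel)
open import Relation.Binary.Construct.Closure.Equivalence using (EqClosure)
open import Relation.Binary.PropositionalEquality.Core using (_≡_)
open import Relation.Nullary.Decidable.Core using (does)

-- The set {1,…,n} is represented by Fin n, with i : Fin n standing for the
-- number label i = toℕ i + 1.

label : ∀ {n} → Fin n → ℕ
label i = suc (toℕ i)

-- The element of {1,…,n} congruent to a modulo n.  In particular
-- label (rep n a) ≡ a whenever 1 ≤ a ≤ n.  Since toℕ is label minus one, the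
-- index is the residue of a - 1, computed as a + (n - 1) to stay in ℕ.

rep : ∀ n .{{_ : NonZero n}} → ℕ → Fin n
rep n a = (a ℕ.+ pred n) mod n

Matrix : ℕ → Set
Matrix n = Fin n → Fin n → ℤ

infix 4 _≐_

_≐_ : ∀ {n} → Rel (Matrix n) 0ℓ
A ≐ B = ∀ i j → A i j ≡ B i j

infixl 7 _·_

_·_ : ∀ {n} → Matrix n → Matrix n → Matrix n
(A · B) i j = sum +-*-semiring (λ k → A i k * B k j)

infix 8 _ᵗ

_ᵗ : ∀ {n} → Matrix n → Matrix n
(A ᵗ) i j = A j i

diagonal : ∀ {n} → (Fin n → ℤ) → Matrix n
diagonal d i j = if does (i ≟ j) then d i else 0ℤ

-- Column j is the standard basis vector with index π(j).

permutationMatrix : ∀ {n} → Permutation′ n → Matrix n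
permutationMatrix π i j = if does (i ≟ π ⟨$⟩ʳ j) then 1ℤ else 0ℤ

-- The same formula makes sense for all square integer matrices and preserves
-- the class of symmetric matrices with zero diagonal and off-diagonal
-- coefficients ±1, to which every linking matrix belongs; so that class is not
-- imposed on X and Y separately.

SwitchingEquivalent : ∀ {n} → Rel (Matrix n) 0ℓ
SwitchingEquivalent {n} X Y =
  ∃₂ λ (π : Permutation′ n) (d : Fin n → ℤ) →
    let P = permutationMatrix π
        D = diagonal d
    in (∀ i → d i ≡ 1ℤ ⊎ d i ≡ -1ℤ) × Y ≐ D · P ᵗ · X · P · D

-- Unlike Data.Integer.Base.sign, this sends 0 to 0.

signum : ℤ → ℤ
signum +0       = 0ℤ
signum +[1+ _ ] = 1ℤ
signum -[1+ _ ] = -1ℤ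

linkingMatrix : ∀ {n} → Permutation′ n → Matrix n
linkingMatrix σ i j =
  signum ((+ label i - + label j) * (+ label (σ ⟨$⟩ʳ i) - + label (σ ⟨$⟩ʳ j)))

-- σ([1,k]) = [1,k] as an equality of sets.

StabilisesBlock : ∀ {n} → Permutation′ n → ℕ → Set
StabilisesBlock σ k =
  ∀ j → (∃ λ i → label i ≤ k × σ ⟨$⟩ʳ i ≡ j) ⇔ label j ≤ k

module _ {n : ℕ} .{{_ : NonZero n}} where

  -- In vertical, both truncated subtractions are exact and land in [1,k],
  -- because i and σ(k + 1 - i) lie in [1,k].

  data SpindleMove (σ μ : Permutation′ n) : Set where

    circular : ∀ s t → s < n → t < n →
      (∀ i → μ ⟨$⟩ʳ i ≡ rep n (s ℕ.+ label (σ ⟨$⟩ʳ rep n (label i ℕ.+ t)))) →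
      SpindleMove σ μ

    vertical : ∀ k → 1 ≤ k → k ≤ n → StabilisesBlock σ k →
      (∀ i → label i ≤ k →
        μ ⟨$⟩ʳ i ≡ rep n (suc k ∸ label (σ ⟨$⟩ʳ rep n (suc k ∸ label i)))) →
      (∀ i → k < label i → μ ⟨$⟩ʳ i ≡ σ ⟨$⟩ʳ i) →
      SpindleMove σ μ

    horizontal : ∀ k → 1 < k → k ≤ n → StabilisesBlock σ k →
      (∀ i → label i ≤ k → μ ⟨$⟩ʳ i ≡ σ ⟨$⟩ˡ i) →
      (∀ i → k < label i → μ ⟨$⟩ʳ i ≡ σ ⟨$⟩ʳ i) →
      SpindleMove σ μ

  -- Permutations that agree pointwise need not be propositionally equal, but
  -- they are related by the circular move with s = t = 0.

  SpindleEquivalent : Rel (Permutation′ n) 0ℓ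
  SpindleEquivalent = EqClosure SpindleMove

{-# OPTIONS --safe #-}
module Submission where

-- Put σ on a vertex set as two linear orders, the positions and the values; the
-- linking signs say on which pairs the orders disagree (the edges of the
-- inversion graph).  Circular moves switch the graph at the vertices that wrap
-- around, and block reflections preserve it, so equivalent permutations have
-- switching-equivalent matrices.
--
-- Conversely, rotate both permutations so that a common vertex comes first in all
-- four orders; it is then isolated, so the two graphs are equal.  Call a pair bad
-- if the two position orders disagree on it.  Colour every pair by the two bits
-- (edge , bad).  For u < v < w in position order the colour of uw is that of uv or
-- of vw, because each of the other three orders is transitive.  Hence, as in
-- Gallai's theorem on rainbow-free colourings, every block has a prefix cut whose
-- crossing pairs use two colours only, that is, edge, bad or edge + bad is
-- constant across the cut.  Reflecting the block vertically complements bad, and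
-- reflecting it horizontally adds edge to bad; so in the last two cases bad
-- can be made to vanish across the cut, and then every bad pair lies in a smaller
-- block, which is sorted by induction.  If edge is constant, sorting the part
-- after the cut by induction yields a smaller such cut or one on which bad is
-- constant.
open import Defs
open import Algebra.Properties.Semiring.Sum using (sum; sum-cong-≗; sum-replicate-zero)
open import Data.Bool.Base using (Bool; true; false; not; _xor_; T; if_then_else_)
import Data.Bool.Properties as Boolₚ
open import Data.Bool.Solver using (module xor-∧-Solver)
open import Data.Fin.Base using (Fin; zero; suc; toℕ; fromℕ<)
open import Data.Fin.Permutation
  using (Permutation′; permutation; id; _⟨$⟩ʳ_; _⟨$⟩ˡ_; inverseˡ; inverseʳ; flip; _∘ₚ_; _≈_)
open import Data.Fin.Properties using (_≟_; toℕ<n; toℕ-injective; toℕ-fromℕ<; injective⇒≤)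
open import Data.Integer.Base as ℤ using (ℤ; +0; +[1+_]; -[1+_]; 0ℤ; 1ℤ; -1ℤ)
import Data.Integer.Properties as ℤₚ
open import Data.List.Base using ([]; _∷_; allFin; cartesianProduct)
open import Data.List.Membership.Propositional using (_∈_)
open import Data.List.Membership.Propositional.Properties using (∈-allFin; ∈-cartesianProduct⁺)
open import Data.List.Relation.Unary.Any using (here; there)
open import Data.Nat.Base
open import Data.Nat.DivMod
open import Data.Nat.Induction using (<-wellFounded)
open import Data.Nat.Properties hiding (_≟_)
import Data.Nat.Properties as ℕₚ
open import Data.Product.Base using (_×_; _,_; ∃; ∃₂; proj₁; proj₂)
open import Data.Product.Properties using (≡-dec)
open import Data.Sum.Base using (_⊎_; inj₁; inj₂; [_,_]′)
open import Data.Unit.Base using (tt)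
open import Function.Base using (_∘_; case_of_)
open import Function.Bundles using (_⇔_; Equivalence; mk⇔)
open import Function.Construct.Symmetry using (⇔-sym)
open import Induction.WellFounded using (Acc; acc)
import Relation.Binary.Construct.Closure.Equivalence as Eq
open import Relation.Binary.Definitions using (DecidableEquality; tri<; tri≈; tri>)
open import Relation.Binary.PropositionalEquality
open import Relation.Binary.Structures using (IsEquivalence)
open import Relation.Nullary using (¬_; Dec; does; yes; no; contradiction)
open import Relation.Nullary.Decidable using (_×-dec_; _⊎-dec_; ¬?; toSum)

-- Boolean comparison of natural numbers.

<⇒<ᵇ-true : ∀ {m n} → m < n → (m <ᵇ n) ≡ true
<⇒<ᵇ-true (s≤s z≤n)         = refl
<⇒<ᵇ-true (s≤s p@(s≤s _)) = <⇒<ᵇ-true p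

≥⇒<ᵇ-false : ∀ {m n} → n ≤ m → (m <ᵇ n) ≡ false
≥⇒<ᵇ-false {n = zero}  z≤n     = refl
≥⇒<ᵇ-false {n = suc _} (s≤s p) = ≥⇒<ᵇ-false p

<ᵇ-true⇒< : ∀ m n → (m <ᵇ n) ≡ true → m < n
<ᵇ-true⇒< m n eq = <ᵇ⇒< m n (subst T (sym eq) tt)

<ᵇ-false⇒≥ : ∀ m n → (m <ᵇ n) ≡ false → n ≤ m
<ᵇ-false⇒≥ m n eq with n ≤? m
... | yes n≤m = n≤m
... | no  n≰m = case trans (sym eq) (<⇒<ᵇ-true (≰⇒> n≰m)) of λ ()

<ᵇ-irrefl : ∀ m → (m <ᵇ m) ≡ false
<ᵇ-irrefl m = ≥⇒<ᵇ-false (≤-refl {m})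

<ᵇ-flip : ∀ {m n} → m ≢ n → (n <ᵇ m) ≡ not (m <ᵇ n)
<ᵇ-flip {m} {n} m≢n with <-cmp m n
... | tri< m<n _ _ = trans (≥⇒<ᵇ-false (<⇒≤ m<n)) (cong not (sym (<⇒<ᵇ-true m<n)))
... | tri≈ _ m≡n _ = contradiction m≡n m≢n
... | tri> _ _ n<m = trans (<⇒<ᵇ-true n<m) (cong not (sym (≥⇒<ᵇ-false (<⇒≤ n<m))))

-- Swapping the arguments complements both comparisons or, on equal arguments, neither; the sum is
-- the same either way.
<ᵇ-xor-sym : ∀ m n o p → (m ≡ n → o ≡ p) → (o ≡ p → m ≡ n) →
             (m <ᵇ n) xor (o <ᵇ p) ≡ (n <ᵇ m) xor (p <ᵇ o)
<ᵇ-xor-sym m n o p f g with m ℕₚ.≟ n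
... | yes refl rewrite f refl = refl
... | no  m≢n rewrite <ᵇ-flip m≢n | <ᵇ-flip (m≢n ∘ g) =
  sym (Boolₚ.xor-annihilates-not (m <ᵇ n) (o <ᵇ p))

-- For `x`, `y`, `z` the comparisons of uv, vw and uw in a linear order, this is transitivity of the
-- order and of its complement in one condition.
Convex : Bool → Bool → Bool → Set
Convex x y z = x ≡ y → z ≡ x

<ᵇ-convex : ∀ m n o → Convex (m <ᵇ n) (n <ᵇ o) (m <ᵇ o)
<ᵇ-convex m n o eq with m <ᵇ n in mn | n <ᵇ o in no
... | true  | true  = <⇒<ᵇ-true (<-trans (<ᵇ-true⇒< m n mn) (<ᵇ-true⇒< n o no))
... | false | false = ≥⇒<ᵇ-false (≤-trans (<ᵇ-false⇒≥ n o no) (<ᵇ-false⇒≥ m n mn))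

convex-not : ∀ {x y z} → Convex x y z → Convex (not x) (not y) (not z)
convex-not c eq = cong not (c (Boolₚ.not-injective eq))

-- Colourings of the pairs of a line

Colour : Set
Colour = Bool × Bool

_≟ᶜ_ : DecidableEquality Colour
_≟ᶜ_ = ≡-dec Boolₚ._≟_ Boolₚ._≟_

xor-cancelˡ : ∀ x {y z} → x xor y ≡ x xor z → y ≡ z
xor-cancelˡ true  eq = Boolₚ.not-injective eq
xor-cancelˡ false eq = eq

≢⇒covers : ∀ {x y} z → x ≢ y → z ≡ x ⊎ z ≡ y
≢⇒covers {x} {y} z x≢y with z Boolₚ.≟ x
... | yes z≡x = inj₁ z≡x
... | no  z≢x = inj₂ (Boolₚ.not-injective
  (trans (sym (Boolₚ.¬-not (z≢x ∘ sym))) (Boolₚ.¬-not x≢y)))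

-- Two distinct pairs of bits agree in exactly one of the first bit, the second
-- bit and their sum, so three convexity conditions leave two values for (z , z′).

convex-colours : ∀ {x y z x′ y′ z′} → Convex x y z → Convex x′ y′ z′ →
  Convex (x xor x′) (y xor y′) (z xor z′) →
  ((z , z′) ≡ (x , x′)) ⊎ ((z , z′) ≡ (y , y′))
convex-colours {x} {y} {z} {x′} {y′} {z′} f g h with x Boolₚ.≟ y | x′ Boolₚ.≟ y′
... | yes refl | yes x′≡y′ = inj₁ (cong₂ _,_ (f refl) (g x′≡y′))
... | yes refl | no  x′≢y′ with ≢⇒covers z′ x′≢y′
...   | inj₁ e = inj₁ (cong₂ _,_ (f refl) e)
...   | inj₂ e = inj₂ (cong₂ _,_ (f refl) e)
convex-colours {x} {y} {z} {x′} {y′} {z′} f g h | no x≢y | yes refl with ≢⇒covers z x≢y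
...   | inj₁ e = inj₁ (cong₂ _,_ e (g refl))
...   | inj₂ e = inj₂ (cong₂ _,_ e (g refl))
convex-colours {x} {y} {z} {x′} {y′} {z′} f g h | no x≢y | no x′≢y′ with ≢⇒covers z x≢y
...   | inj₁ refl = inj₁ (cong₂ _,_ refl (xor-cancelˡ z (h sums)))
  where
  sums : x xor x′ ≡ y xor y′
  sums rewrite Boolₚ.¬-not x≢y | Boolₚ.¬-not x′≢y′ = Boolₚ.xor-annihilates-not y y′
...   | inj₂ refl = inj₂ (cong₂ _,_ refl (xor-cancelˡ z (trans (h sums) sums)))
  where
  sums : x xor x′ ≡ y xor y′
  sums rewrite Boolₚ.¬-not x≢y | Boolₚ.¬-not x′≢y′ = Boolₚ.xor-annihilates-not y y′

-- The nonzero linear functionals on colours, viewed as vectors over F₂.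

data Functional : Set where
  first second total : Functional

eval : Functional → Colour → Bool
eval first  (x , y) = x
eval second (x , y) = y
eval total  (x , y) = x xor y

-- In a plane over F₂ every vector, here the difference of the two colours, is annihilated by a
-- nonzero functional. So pairs that use at most two colours are uniform under some `eval F`.
collinear : ∀ c c′ → ∃ λ F → eval F c ≡ eval F c′
collinear (x , y) (x′ , y′) with x Boolₚ.≟ x′ | y Boolₚ.≟ y′
... | yes e | _     = first , e
... | no  _ | yes e = second , e
... | no  e | no e′ = total , trans (cong₂ _xor_ (Boolₚ.¬-not e) (Boolₚ.¬-not e′))
                                    (Boolₚ.xor-annihilates-not x′ y′)

-- `Q` carries whatever data a failing index provides, so that the failure can be used without
-- further inspection of `P`.
range-search : ∀ {P : ℕ → Set} {Q : Set} l r →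
  (∀ i → l ≤ i → i < r → P i ⊎ Q) → (∀ i → l ≤ i → i < r → P i) ⊎ Q
range-search l zero    f = inj₁ λ _ _ ()
range-search {P} l (suc r) f with range-search l r (λ i l≤i i<r → f i l≤i (m<n⇒m<1+n i<r))
... | inj₂ q = inj₂ q
... | inj₁ g with l ≤? r
...   | no  l≰r = inj₁ λ i l≤i i<1+r → contradiction (≤-trans l≤i (≤-pred i<1+r)) l≰r
...   | yes l≤r with f r l≤r ≤-refl
...     | inj₂ q = inj₂ q
...     | inj₁ p = inj₁ λ i l≤i i<1+r → case m≤n⇒m<n∨m≡n (≤-pred i<1+r) of λ where
            (inj₁ i<r)  → g i l≤i i<r
            (inj₂ refl) → p

module _ {D : Set} (_≟ᴰ_ : DecidableEquality D) (d : ℕ → D) where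

  -- A nonconstant function on an interval differs at two neighbours; the gap between them is where
  -- cuts are made.
  constant-or-change : ∀ l r → (∀ i → l ≤ i → i < r → d i ≡ d l) ⊎
                       (∃ λ j → l ≤ j × suc j < r × d j ≢ d (suc j))
  constant-or-change l zero = inj₁ λ _ _ ()
  constant-or-change l (suc r) with <-cmp l r
  ... | tri≈ _ refl _ = inj₁ λ i l≤i i<1+l → cong d (≤-antisym (≤-pred i<1+l) l≤i)
  ... | tri> l≮r l≢r _ = inj₁ λ i l≤i i<1+r →
          contradiction (≤∧≢⇒< (≤-trans l≤i (≤-pred i<1+r)) l≢r) l≮r
  constant-or-change l (suc (suc r)) | tri< l<1+r _ _ with constant-or-change l (suc r)
  ... | inj₂ (j , l≤j , 1+j<r , dj≢) = inj₂ (j , l≤j , m<n⇒m<1+n 1+j<r , dj≢)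
  ... | inj₁ const with d r ≟ᴰ d (suc r)
  ...   | no  neq = inj₂ (r , ≤-pred l<1+r , ≤-refl , neq)
  ...   | yes eq  = inj₁ λ i l≤i i<2+r → case m≤n⇒m<n∨m≡n (≤-pred i<2+r) of λ where
            (inj₁ i<1+r) → const i l≤i i<1+r
            (inj₂ refl)  → trans (sym eq) (const r (≤-pred l<1+r) ≤-refl)

module Colouring (N : ℕ) (col : ℕ → ℕ → Colour)
  (col-sym : ∀ i j → col i j ≡ col j i)
  (between : ∀ {i j k} → i < j → j < k → k < N →
             col i k ≡ col i j ⊎ col i k ≡ col j k)
  where

  Cut : Functional → Bool → ℕ → ℕ → ℕ → Set
  Cut F t l k r = ∀ p q → l ≤ p → p < k → k ≤ q → q < r → eval F (col p q) ≡ t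

  between-eval : ∀ F {t p q r} → p < q → q < r → r < N →
                 eval F (col p q) ≡ t → eval F (col q r) ≡ t → eval F (col p r) ≡ t
  between-eval F p<q q<r r<N e e′ with between p<q q<r r<N
  ... | inj₁ eq = trans (cong (eval F) eq) e
  ... | inj₂ eq = trans (cong (eval F) eq) e′

  -- For `p` and `q` on opposite sides with `d p ≡ d q`, one of `j` and `suc j` has another value of
  -- `d` and lies strictly between them. Both pairs that it forms with `p` and `q` fall under
  -- `cross`, and `between-eval` combines them.
  change⇒cut : ∀ {D : Set} (_≟ᴰ_ : DecidableEquality D) (d : ℕ → D) F t l r → r ≤ N →
    (∀ p q → l ≤ p → p < q → q < r → d p ≢ d q → eval F (col p q) ≡ t) →
    ∀ {j} → suc j < r → d j ≢ d (suc j) → Cut F t l (suc j) r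
  change⇒cut _≟ᴰ_ d F t l r r≤N cross {j} 1+j<r dj≢ p q l≤p p≤j j<q q<r with d p ≟ᴰ d q
  ... | no  neq = cross p q l≤p (<-≤-trans p≤j j<q) q<r neq
  ... | yes eq with d p ≟ᴰ d j
  ...   | yes eq′ = between-eval F p≤j 1+j<q (<-≤-trans q<r r≤N)
            (cross p (suc j) l≤p p≤j 1+j<r (dj≢ ∘ trans (sym eq′)))
            (cross (suc j) q (≤-trans l≤p (<⇒≤ p≤j)) 1+j<q q<r
              (dj≢ ∘ λ e → trans (sym eq′) (trans eq (sym e))))
    where
    1+j<q : suc j < q
    1+j<q = ≤∧≢⇒< j<q λ e → dj≢ (trans (sym eq′) (trans eq (sym (cong d e))))
  ...   | no  neq = between-eval F p<j j<q (<-≤-trans q<r r≤N)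
            (cross p j l≤p p<j (<-trans (n<1+n j) 1+j<r) neq)
            (cross j q (≤-trans l≤p (<⇒≤ p<j)) j<q q<r (neq ∘ trans eq ∘ sym))
    where
    p<j : p < j
    p<j = ≤∧≢⇒< (≤-pred p≤j) (neq ∘ cong d)

  -- Gallai's theorem for these colourings.  When the new vertex v destroys the
  -- cut k, all colours from v to [k,v) coincide; then either {v} can be cut off
  -- or the colours from [l,k) to k change somewhere, at a smaller cut.

  gallai-cut : ∀ l v → l < v → v < N →
               ∃ λ F → ∃ λ t → ∃ λ k → l < k × k ≤ v × Cut F t l k (suc v)
  gallai-cut l (suc v) l≤v@(s≤s l≤v′) v<N with m≤n⇒m<n∨m≡n l≤v′
  ... | inj₂ refl = first , eval first (col v (suc v)) , suc v , ≤-refl , ≤-refl , λ p q l≤p p≤v v<q q≤v →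
        cong₂ (λ x y → eval first (col x y)) (≤-antisym (≤-pred p≤v) l≤p) (≤-antisym (≤-pred q≤v) v<q)
  ... | inj₁ l<v = let F , t , k , l<k , k≤v , cut = gallai-cut l v l<v (<-trans (n<1+n v) v<N)
                   in  extend F t k (<-wellFounded k) l<k k≤v cut
    where
    w = suc v

    extend : ∀ F t k → Acc _<_ k → l < k → k ≤ v → Cut F t l k (suc v) →
             ∃ λ F → ∃ λ t → ∃ λ k → l < k × k ≤ w × Cut F t l k (suc w)
    extend F t k (acc rec) l<k k≤v cut
      with range-search {Q = ∃ λ p → l ≤ p × p < k × eval F (col p w) ≢ t} l k
             (λ p l≤p p<k → case eval F (col p w) Boolₚ.≟ t of λ where
               (yes e) → inj₁ e
               (no ne) → inj₂ (p , l≤p , p<k , ne))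
    ... | inj₁ all = F , t , k , l<k , m≤n⇒m≤1+n k≤v , λ p q l≤p p<k k≤q q≤w →
            case m≤n⇒m<n∨m≡n (≤-pred q≤w) of λ where
              (inj₁ q<w)  → cut p q l≤p p<k k≤q q<w
              (inj₂ refl) → all p l≤p p<k
    ... | inj₂ (p , l≤p , p<k , ne)
      with constant-or-change _≟ᶜ_ (λ i → col i k) l k
    -- Only the colours `col l k` and `col p w` occur between `w` and the earlier vertices; `F′` is
    -- a functional that identifies them.
    ...   | inj₁ const = let F′ , e = collinear (col l k) (col p w) in
            F′ , eval F′ (col l k) , w , m≤n⇒m≤1+n l<v , ≤-refl , λ i q l≤i i<w w≤q q≤w →
            subst (λ q → eval F′ (col i q) ≡ eval F′ (col l k)) (≤-antisym w≤q (≤-pred q≤w))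
              (case <-≤-connex i k of λ where
                (inj₂ k≤i) → trans (cong (eval F′) (tail i k≤i i<w)) (sym e)
                (inj₁ i<k) → case between i<k (s≤s k≤v) v<N of λ where
                  (inj₁ eq) → cong (eval F′) (trans eq (const i l≤i i<k))
                  (inj₂ eq) → trans (cong (eval F′) (trans eq (tail k ≤-refl (s≤s k≤v)))) (sym e))
      where
      tail : ∀ q → k ≤ q → q < w → col q w ≡ col p w
      -- The alternative `col p w ≡ col p q` would give the pair `(p , w)` the value `t` of the old
      -- cut.
      tail q k≤q q<w with between (<-≤-trans p<k k≤q) q<w v<N
      ... | inj₂ eq = sym eq
      ... | inj₁ eq = contradiction (trans (cong (eval F) eq) (cut p q l≤p p<k k≤q q<w)) ne
    ...   | inj₂ (j , l≤j , 1+j<k , dj≢) =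
            extend F t (suc j) (rec 1+j<k) (s≤s l≤j) (≤-trans (<⇒≤ 1+j<k) k≤v) λ x q l≤x x≤j j<q q<w →
              case <-≤-connex q k of λ where
                (inj₁ q<k) → inner x q l≤x x≤j j<q q<k
                (inj₂ k≤q) → cut x q l≤x (<-≤-trans x≤j (<⇒≤ 1+j<k)) k≤q q<w
      where
      k<N : k < N
      k<N = ≤-<-trans k≤v (<-trans (n<1+n v) v<N)
      inner : Cut F t l (suc j) k
      -- If `x` and `y` have different colours to `k`, then `col x y` must equal `col x k`, which
      -- the old cut sends to `t`.
      inner = change⇒cut _≟ᶜ_ (λ i → col i k) F t l k (<⇒≤ k<N)
        (λ x y l≤x x<y y<k neq → case between x<y y<k k<N of λ where
          (inj₁ eq) → trans (cong (eval F) (sym eq)) (cut x k l≤x (<-trans x<y y<k) ≤-refl (s≤s k≤v))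
          (inj₂ eq) → contradiction eq neq)
        1+j<k dj≢

  Outside : ℕ → ℕ → ℕ → Set
  Outside x y w = w < x ⊎ y ≤ w

  Closed : ℕ → ℕ → ℕ → ℕ → Set
  Closed l r x y = ∀ w p → l ≤ w → w < r → Outside x y w → x ≤ p → p < y → proj₂ (col w p) ≡ false

  -- With first bits as edges, `[x,y)` is a module, in the sense of modular decomposition, of the
  -- graph on `[l,r)`.
  Homogeneous : ℕ → ℕ → ℕ → ℕ → Set
  Homogeneous l r x y = ∀ w p q → l ≤ w → w < r → Outside x y w →
    x ≤ p → p < y → x ≤ q → q < y → proj₁ (col w p) ≡ proj₁ (col w q)

  -- If `w` sees `p` and `q` with different first bits, `between` forces the colour of `(p , q)` to
  -- be that of a pair from `w` into the interval, whose second bit is false by closedness. So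
  -- `change⇒cut` applies to the first bits seen from `w`.
  split-closed : ∀ {l r x y} → r ≤ N → y ≤ r → Closed l r x y →
    ∀ {w j} → l ≤ w → w < r → Outside x y w →
    suc j < y → proj₁ (col w j) ≢ proj₁ (col w (suc j)) → Cut second false x (suc j) y
  split-closed {l} {r} {x} {y} r≤N y≤r closed {w} l≤w w<r out =
    change⇒cut Boolₚ._≟_ (λ p → proj₁ (col w p)) second false x y (≤-trans y≤r r≤N) (cross out)
    where
    cross : Outside x y w → ∀ p q → x ≤ p → p < q → q < y →
            proj₁ (col w p) ≢ proj₁ (col w q) → proj₂ (col p q) ≡ false
    cross (inj₁ w<x) p q x≤p p<q q<y neq
      with between (<-≤-trans w<x x≤p) p<q (<-≤-trans q<y (≤-trans y≤r r≤N))
    ... | inj₁ eq = contradiction (sym (cong proj₁ eq)) neq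
    ... | inj₂ eq = trans (cong proj₂ (sym eq)) (closed w q l≤w w<r out (≤-trans x≤p (<⇒≤ p<q)) q<y)
    cross (inj₂ y≤w) p q x≤p p<q q<y neq
      with between p<q (<-≤-trans q<y y≤w) (<-≤-trans w<r r≤N)
    ... | inj₁ eq = trans (cong proj₂ (trans (sym eq) (col-sym p w)))
                          (closed w p l≤w w<r out x≤p (<-trans p<q q<y))
    ... | inj₂ eq = contradiction (cong proj₁ (trans (col-sym w p) (trans eq (col-sym q w)))) neq

  -- A closed interval that is not homogeneous is cut by some outside vertex, and
  -- both ends of a pair whose second bit is set lie on the same side of that cut.

  homogeneous-interval : ∀ l r {u v} → r ≤ N → u < v → proj₂ (col u v) ≡ true →
    ∀ x y → l ≤ x → x ≤ u → v < y → y ≤ r → Closed l r x y →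
    ∃₂ λ x′ y′ → x ≤ x′ × x′ ≤ u × v < y′ × y′ ≤ y × Homogeneous l r x′ y′
  homogeneous-interval l r {u} {v} r≤N u<v bad x y = go x y (<-wellFounded (y ∸ x))
    where
    go : ∀ x y → Acc _<_ (y ∸ x) → l ≤ x → x ≤ u → v < y → y ≤ r → Closed l r x y →
      ∃₂ λ x′ y′ → x ≤ x′ × x′ ≤ u × v < y′ × y′ ≤ y × Homogeneous l r x′ y′
    go x y (acc rec) l≤x x≤u v<y y≤r closed
      with range-search {P = λ w → Outside x y w → ∀ p → x ≤ p → p < y → proj₁ (col w p) ≡ proj₁ (col w x)}
             {Q = ∃ λ w → l ≤ w × w < r × Outside x y w ×
                  ∃ λ j → x ≤ j × suc j < y × proj₁ (col w j) ≢ proj₁ (col w (suc j))} l r search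
      where
      search : _
      search w l≤w w<r with constant-or-change Boolₚ._≟_ (λ p → proj₁ (col w p)) x y
      ... | inj₁ const = inj₁ λ _ → const
      ... | inj₂ change with w <? x | y ≤? w
      ...   | yes w<x | _       = inj₂ (w , l≤w , w<r , inj₁ w<x , change)
      ...   | no  _   | yes y≤w = inj₂ (w , l≤w , w<r , inj₂ y≤w , change)
      ...   | no  w≮x | no  y≰w = inj₁ [ (λ w<x → contradiction w<x w≮x) , (λ y≤w → contradiction y≤w y≰w) ]′
    ... | inj₁ const = x , y , ≤-refl , x≤u , v<y , ≤-refl , λ w p q l≤w w<r out x≤p p<y x≤q q<y →
            trans (const w l≤w w<r out p x≤p p<y) (sym (const w l≤w w<r out q x≤q q<y))
    ... | inj₂ (w , l≤w , w<r , out , j , x≤j , 1+j<y , dj≢)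
      with <-≤-connex v (suc j) | <-≤-connex u (suc j)
         | split-closed r≤N y≤r closed l≤w w<r out 1+j<y dj≢
    ...   | inj₂ j<v | inj₁ u≤j | cut = case trans (sym bad) (cut u v x≤u u≤j j<v v<y) of λ ()
    ...   | inj₁ v≤j | _ | cut =
            let x′ , y′ , x≤x′ , x′≤u , v<y′ , y′≤j , hom =
                  go x (suc j) (rec (∸-monoˡ-< 1+j<y (m≤n⇒m≤1+n x≤j))) l≤x x≤u v≤j
                     (≤-trans (<⇒≤ 1+j<y) y≤r) closed′
            in  x′ , y′ , x≤x′ , x′≤u , v<y′ , ≤-trans y′≤j (<⇒≤ 1+j<y) , hom
      where
      closed′ : Closed l r x (suc j)
      closed′ w p l≤w w<r (inj₁ w<x) x≤p p≤j = closed w p l≤w w<r (inj₁ w<x) x≤p (<-trans p≤j 1+j<y)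
      closed′ w p l≤w w<r (inj₂ j<w) x≤p p≤j with <-≤-connex w y
      ... | inj₁ w<y = trans (cong proj₂ (col-sym w p)) (cut p w x≤p p≤j j<w w<y)
      ... | inj₂ y≤w = closed w p l≤w w<r (inj₂ y≤w) x≤p (<-trans p≤j 1+j<y)
    ...   | inj₂ _ | inj₂ j<u | cut =
            let x′ , y′ , j<x′ , x′≤u , v<y′ , y′≤y , hom =
                  go (suc j) y (rec (∸-monoʳ-< (s≤s x≤j) (<⇒≤ 1+j<y))) (≤-trans l≤x (m≤n⇒m≤1+n x≤j))
                     j<u v<y y≤r closed′
            in  x′ , y′ , ≤-trans (m≤n⇒m≤1+n x≤j) j<x′ , x′≤u , v<y′ , y′≤y , hom
      where
      closed′ : Closed l r (suc j) y
      closed′ w p l≤w w<r (inj₂ y≤w) j<p p<y =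
        closed w p l≤w w<r (inj₂ y≤w) (≤-trans (m≤n⇒m≤1+n x≤j) j<p) p<y
      closed′ w p l≤w w<r (inj₁ w≤j) j<p p<y with <-≤-connex w x
      ... | inj₁ w<x = closed w p l≤w w<r (inj₁ w<x) (≤-trans (m≤n⇒m≤1+n x≤j) j<p) p<y
      ... | inj₂ x≤w = cut w p x≤w w≤j j<p p<y

  -- If no pair in [m,r) has its second bit set, then the q in [m,r) for which the
  -- pair (p , q) has it set form an initial part of [m,r), for each p in [l,m).
  -- When this part is the same for all p, it ends at a cut.

  shuffle-cut : ∀ {e l m r} → r ≤ N → l < m → m < r → Cut first e l m r →
    (∀ q q′ → m ≤ q → q < q′ → q′ < r → proj₂ (col q q′) ≡ false) →
    (∃ λ j → l ≤ j × suc j < m × Cut first e l (suc j) r) ⊎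
    (∃₂ λ m′ b → l < m′ × m′ < r × Cut second b l m′ r)
  shuffle-cut {e} {l} {m} {r} r≤N l<m m<r cut good
    with range-search {P = λ q → ∀ p → l ≤ p → p < m → proj₂ (col p q) ≡ proj₂ (col l q)}
           {Q = ∃ λ j → l ≤ j × suc j < m × Cut first e l (suc j) r} m r search
    where
    search : ∀ q → m ≤ q → q < r → (∀ p → l ≤ p → p < m → proj₂ (col p q) ≡ proj₂ (col l q)) ⊎
             (∃ λ j → l ≤ j × suc j < m × Cut first e l (suc j) r)
    search q m≤q q<r with constant-or-change Boolₚ._≟_ (λ p → proj₂ (col p q)) l m
    ... | inj₁ const = inj₁ const
    ... | inj₂ (j , l≤j , 1+j<m , dj≢) = inj₂ (j , l≤j , 1+j<m , λ x y l≤x x≤j j<y y<r →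
            case <-≤-connex y m of λ where
              (inj₁ y<m) → inner x y l≤x x≤j j<y y<m
              (inj₂ m≤y) → cut x y l≤x (<-trans x≤j 1+j<m) m≤y y<r)
      where
      inner : Cut first e l (suc j) m
      -- If `q` separates `x` and `y` by the second bit, `between` gives the pair `(x , y)` the
      -- colour of `(x , q)`, whose first bit is `e`.
      inner = change⇒cut Boolₚ._≟_ (λ p → proj₂ (col p q)) first e l m (≤-trans (<⇒≤ m<r) r≤N)
        (λ x y l≤x x<y y<m neq → case between x<y (<-≤-trans y<m m≤q) (<-≤-trans q<r r≤N) of λ where
          (inj₁ eq) → trans (cong proj₁ (sym eq)) (cut x q l≤x (<-trans x<y y<m) m≤q q<r)
          (inj₂ eq) → contradiction (cong proj₂ eq) neq)
        1+j<m dj≢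
  ... | inj₂ smaller = inj₁ smaller
  ... | inj₁ const with constant-or-change Boolₚ._≟_ (λ q → proj₂ (col l q)) m r
  ...   | inj₁ all = inj₂ (m , proj₂ (col l m) , l<m , m<r , λ p q l≤p p<m m≤q q<r →
            trans (const q m≤q q<r p l≤p p<m) (all q m≤q q<r))
  -- A false bit persists to the right because no pair in `[m,r)` has its second bit set; hence the
  -- change at `j` is from `true` to `false`.
  ...   | inj₂ (j , m≤j , 1+j<r , dj≢) = inj₂ (suc j , false , <-≤-trans l<m (m≤n⇒m≤1+n m≤j) , 1+j<r , second-cut)
    where
    persists : ∀ {q q′} → m ≤ q → q < q′ → q′ < r → proj₂ (col l q) ≡ false → proj₂ (col l q′) ≡ false
    persists m≤q q<q′ q′<r d with between (<-≤-trans l<m m≤q) q<q′ (<-≤-trans q′<r r≤N)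
    ... | inj₁ eq = trans (cong proj₂ eq) d
    ... | inj₂ eq = trans (cong proj₂ eq) (good _ _ m≤q q<q′ q′<r)

    dj≡true : proj₂ (col l j) ≡ true
    dj≡true = Boolₚ.¬-not λ d → dj≢ (trans d (sym (persists m≤j ≤-refl 1+j<r d)))

    before : ∀ p → m ≤ p → p < suc j → proj₂ (col l p) ≡ true
    before p m≤p p≤j = Boolₚ.¬-not λ d → case m≤n⇒m<n∨m≡n (≤-pred p≤j) of λ where
      (inj₁ p<j)  → case trans (sym dj≡true) (persists m≤p p<j (<-trans (n<1+n j) 1+j<r) d) of λ ()
      (inj₂ refl) → case trans (sym dj≡true) d of λ ()

    after : ∀ q → suc j ≤ q → q < r → proj₂ (col l q) ≡ false
    after q j<q q<r = case m≤n⇒m<n∨m≡n j<q of λ where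
        (inj₁ 1+j<q) → persists (m≤n⇒m≤1+n m≤j) 1+j<q q<r d
        (inj₂ refl)  → d
      where
      d : proj₂ (col l (suc j)) ≡ false
      d = Boolₚ.¬-not λ d → dj≢ (trans dj≡true (sym d))

    second-cut : Cut second false l (suc j) r
    second-cut p q l≤p p≤j j<q q<r with <-≤-connex p m
    ... | inj₁ p<m = trans (const q (≤-trans m≤j (<⇒≤ j<q)) q<r p l≤p p<m) (after q j<q q<r)
    ... | inj₂ m≤p with between (<-≤-trans l<m m≤p) (<-≤-trans p≤j j<q) (<-≤-trans q<r r≤N)
    ...   | inj₁ eq = case trans (sym (before p m≤p p≤j)) (trans (sym (cong proj₂ eq)) (after q j<q q<r)) of λ ()
    ...   | inj₂ eq = trans (sym (cong proj₂ eq)) (after q j<q q<r)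

-- Moves as rotations and reflections

⟨$⟩ʳ-injective : ∀ {n} (π : Permutation′ n) {i j} → π ⟨$⟩ʳ i ≡ π ⟨$⟩ʳ j → i ≡ j
⟨$⟩ʳ-injective π eq = trans (sym (inverseˡ π)) (trans (cong (π ⟨$⟩ˡ_) eq) (inverseˡ π))

-- The map of labels a to k + 1 - a on [1,k], written for indices that start at zero and extended by
-- the identity.
reflectℕ : ℕ → ℕ → ℕ
reflectℕ k i = if i <ᵇ k then k ∸ suc i else i

reflectℕ-< : ∀ {k i} → i < k → reflectℕ k i ≡ k ∸ suc i
reflectℕ-< i<k rewrite <⇒<ᵇ-true i<k = refl

reflectℕ-≥ : ∀ {k i} → k ≤ i → reflectℕ k i ≡ i
reflectℕ-≥ k≤i rewrite ≥⇒<ᵇ-false k≤i = refl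

k∸1+i<k : ∀ {k i} → i < k → k ∸ suc i < k
k∸1+i<k {suc k} {i} _ = s≤s (m∸n≤m k i)

reflectℕ-involutive : ∀ k i → reflectℕ k (reflectℕ k i) ≡ i
reflectℕ-involutive k i with <-≤-connex i k
... | inj₂ k≤i = trans (cong (reflectℕ k) (reflectℕ-≥ k≤i)) (reflectℕ-≥ k≤i)
... | inj₁ i<k = trans (cong (reflectℕ k) (reflectℕ-< i<k))
        (trans (reflectℕ-< (k∸1+i<k i<k)) (lemma i<k))
  where
  lemma : ∀ {k i} → i < k → k ∸ suc (k ∸ suc i) ≡ i
  lemma {suc k} (s≤s i≤k) = m∸[m∸n]≡n i≤k

reflect-reverses : ∀ {k i j} → i < k → j < k → (k ∸ suc i <ᵇ k ∸ suc j) ≡ (j <ᵇ i)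
reflect-reverses {k} {i} {j} i<k j<k with <-≤-connex j i
... | inj₁ j<i = trans (<⇒<ᵇ-true (∸-monoʳ-< (s≤s j<i) i<k)) (sym (<⇒<ᵇ-true j<i))
... | inj₂ i≤j = trans (≥⇒<ᵇ-false (∸-monoʳ-≤ k (s≤s i≤j))) (sym (≥⇒<ᵇ-false i≤j))

<ᵇ-+ : ∀ l {m n} → (l + m <ᵇ l + n) ≡ (m <ᵇ n)
<ᵇ-+ zero    = refl
<ᵇ-+ (suc l) = <ᵇ-+ l

module _ {n : ℕ} .{{_ : NonZero n}} where

  toℕ-mod : ∀ m → toℕ (m mod n) ≡ m % n
  toℕ-mod m = toℕ-fromℕ< (m%n<n m n)

  toℕ-mod-< : ∀ {m} → m < n → toℕ (m mod n) ≡ m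
  toℕ-mod-< m<n = trans (toℕ-mod _) (m<n⇒m%n≡m m<n)

  shift : ℕ → Fin n → Fin n
  shift l i = (toℕ i + l) mod n

  shift-shift : ∀ l m k i → l + m ≡ k * n → shift m (shift l i) ≡ i
  shift-shift l m k i eq = toℕ-injective (begin
    toℕ (shift m (shift l i))            ≡⟨ toℕ-mod _ ⟩
    (toℕ (shift l i) + m) % n            ≡⟨ cong (λ x → (x + m) % n) (toℕ-mod _) ⟩
    ((toℕ i + l) % n + m) % n            ≡⟨ %-distribˡ-+ ((toℕ i + l) % n) m n ⟩
    ((toℕ i + l) % n % n + m % n) % n    ≡⟨ cong (λ x → (x + m % n) % n) (m%n%n≡m%n (toℕ i + l) n) ⟩
    ((toℕ i + l) % n + m % n) % n        ≡⟨ %-distribˡ-+ (toℕ i + l) m n ⟨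
    (toℕ i + l + m) % n                  ≡⟨ cong (_% n) (trans (+-assoc (toℕ i) l m) (cong (toℕ i +_) eq)) ⟩
    (toℕ i + k * n) % n                  ≡⟨ [m+kn]%n≡m%n (toℕ i) k n ⟩
    toℕ i % n                            ≡⟨ m<n⇒m%n≡m (toℕ<n i) ⟩
    toℕ i                                ∎)
    where open ≡-Reasoning

  -- The inverse is again a forward shift, by `l * pred n`, because `l + l * pred n` is a multiple
  -- of `n`.
  rotate : ℕ → Permutation′ n
  rotate l = permutation (shift l) (shift (l * pred n))
    (λ i → shift-shift (l * pred n) l l i (trans (+-comm (l * pred n) l) full))
    (λ i → shift-shift l (l * pred n) l i full)
    where
    full : l + l * pred n ≡ l * n
    full = trans (sym (*-suc l (pred n))) (cong (l *_) (suc-pred n))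

  -- The passage from labels to indices that start at zero; it turns the formulas of the moves into
  -- `rotate` and `reflect`.
  rep-suc : ∀ m → rep n (suc m) ≡ m mod n
  rep-suc m = toℕ-injective (begin
    toℕ ((suc m + pred n) mod n) ≡⟨ toℕ-mod _ ⟩
    (suc m + pred n) % n         ≡⟨ cong (_% n) (sym (+-suc m (pred n))) ⟩
    (m + suc (pred n)) % n       ≡⟨ cong (λ x → (m + x) % n) (suc-pred n) ⟩
    (m + n) % n                  ≡⟨ [m+n]%n≡m%n m n ⟩
    m % n                        ≡⟨ toℕ-mod m ⟨
    toℕ (m mod n)                ∎)
    where open ≡-Reasoning

  rep-label-+ : ∀ i t → rep n (label i + t) ≡ rotate t ⟨$⟩ʳ i
  rep-label-+ i t = rep-suc (toℕ i + t)

  rep-+-label : ∀ s i → rep n (s + label i) ≡ rotate s ⟨$⟩ʳ i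
  rep-+-label s i = trans (cong (rep n) (+-comm s (label i))) (rep-label-+ i s)

  reflect : ∀ k → k ≤ n → Permutation′ n
  reflect k k≤n = permutation f f involutive involutive
    where
    f : Fin n → Fin n
    f i = reflectℕ k (toℕ i) mod n
    bound : ∀ i → reflectℕ k (toℕ i) < n
    bound i with <-≤-connex (toℕ i) k
    ... | inj₁ i<k = subst (_< n) (sym (reflectℕ-< i<k)) (<-≤-trans (k∸1+i<k i<k) k≤n)
    ... | inj₂ k≤i = subst (_< n) (sym (reflectℕ-≥ k≤i)) (toℕ<n i)
    involutive : ∀ i → f (f i) ≡ i
    involutive i = toℕ-injective (begin
      toℕ (f (f i))                     ≡⟨ toℕ-mod-< (bound (f i)) ⟩
      reflectℕ k (toℕ (f i))            ≡⟨ cong (reflectℕ k) (toℕ-mod-< (bound i)) ⟩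
      reflectℕ k (reflectℕ k (toℕ i))   ≡⟨ reflectℕ-involutive k (toℕ i) ⟩
      toℕ i                             ∎)
      where open ≡-Reasoning

  toℕ-reflect-< : ∀ k k≤n i → toℕ i < k → toℕ (reflect k k≤n ⟨$⟩ʳ i) ≡ k ∸ suc (toℕ i)
  toℕ-reflect-< k k≤n i i<k = trans (cong (λ x → toℕ (x mod n)) (reflectℕ-< i<k))
    (toℕ-mod-< (<-≤-trans (k∸1+i<k i<k) k≤n))

  reflect-≥ : ∀ k k≤n i → k ≤ toℕ i → reflect k k≤n ⟨$⟩ʳ i ≡ i
  reflect-≥ k k≤n i k≤i = toℕ-injective
    (trans (cong (λ x → toℕ (x mod n)) (reflectℕ-≥ k≤i)) (toℕ-mod-< (toℕ<n i)))

  rep-reflect : ∀ k k≤n i → toℕ i < k → rep n (suc k ∸ label i) ≡ reflect k k≤n ⟨$⟩ʳ i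
  rep-reflect k k≤n i i<k = trans
    (cong (rep n) (∸-suc i<k))
    (trans (rep-suc _) (cong (_mod n) (sym (reflectℕ-< i<k))))
    where
    ∸-suc : ∀ {k i} → i < k → k ∸ i ≡ suc (k ∸ suc i)
    ∸-suc {suc k} {zero}  _         = refl
    ∸-suc {suc k} {suc i} (s≤s i<k) = ∸-suc i<k

  stabilises⇒⇔ : ∀ {σ : Permutation′ n} {k} → StabilisesBlock σ k →
                 ∀ i → toℕ i < k ⇔ toℕ (σ ⟨$⟩ʳ i) < k
  stabilises⇒⇔ {σ} {k} stab i = mk⇔
    (λ i<k → Equivalence.to (stab _) (i , i<k , refl))
    (λ σi<k → let j , j<k , eq = Equivalence.from (stab _) σi<k
              in  subst (λ j → toℕ j < k) (⟨$⟩ʳ-injective σ eq) j<k)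

  ⇔⇒stabilises : ∀ {σ : Permutation′ n} {k} → (∀ i → toℕ i < k ⇔ toℕ (σ ⟨$⟩ʳ i) < k) →
                 StabilisesBlock σ k
  ⇔⇒stabilises {σ} {k} h j = mk⇔
    (λ (i , i<k , eq) → subst (λ j → toℕ j < k) eq (Equivalence.to (h i) i<k))
    (λ j<k → σ ⟨$⟩ˡ j
           , Equivalence.from (h _) (subst (λ j → toℕ j < k) (sym (inverseʳ σ)) j<k)
           , inverseʳ σ)

  module _ {σ μ : Permutation′ n} where

    circular-move : ∀ s t → s < n → t < n →
      (∀ i → μ ⟨$⟩ʳ i ≡ rotate s ⟨$⟩ʳ (σ ⟨$⟩ʳ (rotate t ⟨$⟩ʳ i))) → SpindleMove σ μ
    circular-move s t s<n t<n h = circular s t s<n t<n λ i → trans (h i)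
      (trans (sym (rep-+-label s _)) (cong (λ x → rep n (s + label (σ ⟨$⟩ʳ x))) (sym (rep-label-+ i t))))

    vertical-move : ∀ k (k≤n : k ≤ n) → 1 ≤ k → (∀ i → toℕ i < k ⇔ toℕ (σ ⟨$⟩ʳ i) < k) →
      (∀ i → μ ⟨$⟩ʳ i ≡ reflect k k≤n ⟨$⟩ʳ (σ ⟨$⟩ʳ (reflect k k≤n ⟨$⟩ʳ i))) → SpindleMove σ μ
    vertical-move k k≤n 1≤k stab h = vertical k 1≤k k≤n (⇔⇒stabilises {σ = σ} stab)
      (λ i i<k → trans (h i) (sym (trans
         (cong (λ x → rep n (suc k ∸ label (σ ⟨$⟩ʳ x))) (rep-reflect k k≤n i i<k))
         (rep-reflect k k≤n _ (Equivalence.to (stab _)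
           (subst (_< k) (sym (toℕ-reflect-< k k≤n i i<k)) (k∸1+i<k i<k)))))))
      (λ { i (s≤s k≤i) → trans (h i) (trans
         (cong (λ x → reflect k k≤n ⟨$⟩ʳ (σ ⟨$⟩ʳ x)) (reflect-≥ k k≤n i k≤i))
         (reflect-≥ k k≤n _ (≮⇒≥ λ σi<k → <⇒≱ (Equivalence.from (stab i) σi<k) k≤i))) })

  rotate-0 : ∀ i → rotate 0 ⟨$⟩ʳ i ≡ i
  rotate-0 i = toℕ-injective
    (trans (cong (λ x → toℕ (x mod n)) (+-identityʳ (toℕ i))) (toℕ-mod-< (toℕ<n i)))

  0<n : 0 < n
  0<n = >-nonZero⁻¹ n

  ≈⇒equivalent : ∀ {σ μ : Permutation′ n} → σ ≈ μ → SpindleEquivalent σ μ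
  ≈⇒equivalent {σ} σ≈μ = Eq.return (circular-move 0 0 0<n 0<n λ i →
    trans (sym (σ≈μ i)) (sym (trans (rotate-0 _) (cong (σ ⟨$⟩ʳ_) (rotate-0 i)))))

-- A vertex set Fin n carrying two linear orders, given by ranks.

record Configuration (n : ℕ) : Set where
  constructor ⟨_,_⟩
  field
    pos val : Permutation′ n

  -- `∘ₚ` composes from left to right: a position goes to its vertex and then to the value of that
  -- vertex. Renaming the vertices leaves the result unchanged.
  spindle : Permutation′ n
  spindle = flip pos ∘ₚ val

open Configuration public

-- Given by start and length, since the same set of vertices will have one length but different
-- starts in the two orders.
Block : ∀ {n} → ℕ → ℕ → Fin n → Set
Block l k i = l ≤ toℕ i × toℕ i < l + k

module _ {n : ℕ} .{{_ : NonZero n}} where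

  rotated : ℕ → ℕ → Configuration n → Configuration n
  rotated l l′ c = ⟨ pos c ∘ₚ rotate l , val c ∘ₚ rotate l′ ⟩

  unrotated : ℕ → ℕ → Configuration n → Configuration n
  unrotated l l′ c = ⟨ pos c ∘ₚ flip (rotate l) , val c ∘ₚ flip (rotate l′) ⟩

  -- Rotating the values is a circular move. Rotating the positions is one read backwards, since
  -- `pos` enters the spindle through its inverse.
  rotated-equivalent : ∀ {l l′} c → l < n → l′ < n →
    SpindleEquivalent (spindle c) (spindle (rotated l l′ c))
  rotated-equivalent {l} {l′} c l<n l′<n =
    Eq.transitive _
      (Eq.return (circular-move {μ = spindle c′} l′ 0 l′<n 0<n λ i →
        cong (λ x → rotate l′ ⟨$⟩ʳ (val c ⟨$⟩ʳ (pos c ⟨$⟩ˡ x))) (sym (rotate-0 i))))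
      (Eq.symmetric _ (Eq.return (circular-move 0 l 0<n l<n λ i →
        sym (trans (rotate-0 _) (cong (λ x → val c′ ⟨$⟩ʳ (pos c ⟨$⟩ˡ x)) (inverseˡ (rotate l)))))))
    where
    c′ : Configuration n
    c′ = ⟨ pos c , val c ∘ₚ rotate l′ ⟩

  unrotated-equivalent : ∀ {l l′} c → l < n → l′ < n →
    SpindleEquivalent (spindle c) (spindle (unrotated l l′ c))
  unrotated-equivalent {l} {l′} c l<n l′<n = Eq.transitive _
    (≈⇒equivalent λ i → sym (trans (inverseʳ (rotate l′))
      (cong (λ x → val c ⟨$⟩ʳ (pos c ⟨$⟩ˡ x)) (inverseʳ (rotate l)))))
    (Eq.symmetric _ (rotated-equivalent (unrotated l l′ c) l<n l′<n))

  -- Because `l + k ≤ n`, the rotation by `l` carries `[0,k)` onto `[l,l+k)` without wrapping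
  -- around. In this way moves on initial blocks become available on all blocks.
  module RotatedBlock (l k : ℕ) (l+k≤n : l + k ≤ n) where

    rotate-inner : ∀ q → toℕ q < k → toℕ (rotate l ⟨$⟩ʳ q) ≡ l + toℕ q
    rotate-inner q q<k = trans (toℕ-mod-< (<-≤-trans (subst (_< l + k) (+-comm l (toℕ q)) (+-monoʳ-< l q<k)) l+k≤n))
                               (+-comm (toℕ q) l)

    rotate-block : ∀ q → toℕ q < k → Block l k (rotate l ⟨$⟩ʳ q)
    rotate-block q q<k rewrite rotate-inner q q<k = m≤m+n l (toℕ q) , +-monoʳ-< l q<k

    unrotate-inner : ∀ p → Block l k p → toℕ (rotate l ⟨$⟩ˡ p) < k
    unrotate-inner p (l≤p , p<l+k) =
      subst (_< k) (sym (trans (cong toℕ eq) x-toℕ)) x<k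
      where
      x<k : toℕ p ∸ l < k
      x<k = subst (toℕ p ∸ l <_) (m+n∸m≡n l k) (∸-monoˡ-< p<l+k l≤p)
      x-toℕ : toℕ ((toℕ p ∸ l) mod n) ≡ toℕ p ∸ l
      x-toℕ = toℕ-mod-< (≤-<-trans (m∸n≤m (toℕ p) l) (toℕ<n p))
      eq : rotate l ⟨$⟩ˡ p ≡ (toℕ p ∸ l) mod n
      eq = trans (cong (rotate l ⟨$⟩ˡ_) (toℕ-injective (sym (trans
             (rotate-inner _ (subst (_< k) (sym x-toℕ) x<k))
             (trans (cong (l +_) x-toℕ) (m+[n∸m]≡n l≤p))))))
             (inverseˡ (rotate l))

    unrotate-toℕ : ∀ p → Block l k p → toℕ p ≡ l + toℕ (rotate l ⟨$⟩ˡ p)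
    unrotate-toℕ p b = trans (cong toℕ (sym (inverseʳ (rotate l))))
      (rotate-inner _ (unrotate-inner p b))

    unrotate-outer : ∀ p → ¬ Block l k p → k ≤ toℕ (rotate l ⟨$⟩ˡ p)
    unrotate-outer p ¬b = ≮⇒≥ λ q<k →
      ¬b (subst (Block l k) (inverseʳ (rotate l)) (rotate-block _ q<k))

-- Changing the two orders inside a block.

precedes : ∀ {n} → Permutation′ n → Fin n → Fin n → Bool
precedes p u v = toℕ (p ⟨$⟩ʳ u) <ᵇ toℕ (p ⟨$⟩ʳ v)

-- By `h` the same vertices have rank below `k` in `p` and in `q`, so the two pieces have
-- complementary ranges and glue to a bijection.
exchange : ∀ {n} k (p q : Permutation′ n) →
           (∀ u → toℕ (p ⟨$⟩ʳ u) < k ⇔ toℕ (q ⟨$⟩ʳ u) < k) → Permutation′ n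
exchange {n} k p q h = permutation to from to-from from-to
  where
  to from : Fin n → Fin n
  to u   = if toℕ (p ⟨$⟩ʳ u) <ᵇ k then q ⟨$⟩ʳ u else p ⟨$⟩ʳ u
  from i = if toℕ i <ᵇ k then q ⟨$⟩ˡ i else p ⟨$⟩ˡ i
  to-from : ∀ i → to (from i) ≡ i
  to-from i with <-≤-connex (toℕ i) k
  ... | inj₁ i<k rewrite <⇒<ᵇ-true i<k
        | <⇒<ᵇ-true (Equivalence.from (h (q ⟨$⟩ˡ i)) (subst (λ x → toℕ x < k) (sym (inverseʳ q)) i<k))
        = inverseʳ q
  ... | inj₂ k≤i rewrite ≥⇒<ᵇ-false k≤i | inverseʳ p {i} | ≥⇒<ᵇ-false k≤i = refl
  from-to : ∀ u → from (to u) ≡ u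
  from-to u with <-≤-connex (toℕ (p ⟨$⟩ʳ u)) k
  ... | inj₁ pu<k rewrite <⇒<ᵇ-true pu<k | <⇒<ᵇ-true (Equivalence.to (h u) pu<k) = inverseˡ q
  ... | inj₂ k≤pu rewrite ≥⇒<ᵇ-false k≤pu | ≥⇒<ᵇ-false k≤pu = inverseˡ p

module _ {n} k (p q : Permutation′ n) (h : ∀ u → toℕ (p ⟨$⟩ʳ u) < k ⇔ toℕ (q ⟨$⟩ʳ u) < k) where

  exchange-< : ∀ u → toℕ (p ⟨$⟩ʳ u) < k → exchange k p q h ⟨$⟩ʳ u ≡ q ⟨$⟩ʳ u
  exchange-< u pu<k rewrite <⇒<ᵇ-true pu<k = refl

  exchange-≥ : ∀ u → k ≤ toℕ (p ⟨$⟩ʳ u) → exchange k p q h ⟨$⟩ʳ u ≡ p ⟨$⟩ʳ u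
  exchange-≥ u k≤pu rewrite ≥⇒<ᵇ-false k≤pu = refl

  exchange-from-< : ∀ i → toℕ i < k → exchange k p q h ⟨$⟩ˡ i ≡ q ⟨$⟩ˡ i
  exchange-from-< i i<k rewrite <⇒<ᵇ-true i<k = refl

  exchange-from-≥ : ∀ i → k ≤ toℕ i → exchange k p q h ⟨$⟩ˡ i ≡ p ⟨$⟩ˡ i
  exchange-from-≥ i k≤i rewrite ≥⇒<ᵇ-false k≤i = refl

module _ {n : ℕ} .{{_ : NonZero n}} where

  -- Inverting a spindle interchanges positions and values, so inverting it on the block means
  -- interchanging the two orders there.
  horizontal-move : ∀ k → 1 < k → k ≤ n → (c : Configuration n)
    (h : ∀ u → toℕ (pos c ⟨$⟩ʳ u) < k ⇔ toℕ (val c ⟨$⟩ʳ u) < k) →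
    SpindleMove (spindle c) (spindle ⟨ exchange k (pos c) (val c) h
                                     , exchange k (val c) (pos c) (⇔-sym ∘ h) ⟩)
  horizontal-move k 1<k k≤n c h = horizontal k 1<k k≤n
    (⇔⇒stabilises {σ = spindle c} λ i → mk⇔
      (λ i<k → Equivalence.to (h _) (subst (λ x → toℕ x < k) (sym (inverseʳ (pos c))) i<k))
      (λ σi<k → subst (λ x → toℕ x < k) (inverseʳ (pos c)) (Equivalence.from (h _) σi<k)))
    (λ i i<k → trans (cong (exchange k (val c) (pos c) (⇔-sym ∘ h) ⟨$⟩ʳ_) (exchange-from-< k (pos c) (val c) h i i<k))
      (exchange-< k (val c) (pos c) (⇔-sym ∘ h) _ (subst (λ x → toℕ x < k) (sym (inverseʳ (val c))) i<k)))
    (λ { i (s≤s k≤i) → trans (cong (exchange k (val c) (pos c) (⇔-sym ∘ h) ⟨$⟩ʳ_) (exchange-from-≥ k (pos c) (val c) h i k≤i))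
      (exchange-≥ k (val c) (pos c) (⇔-sym ∘ h) _ (≮⇒≥ λ v<k → <⇒≱ (subst (λ x → toℕ x < k) (inverseʳ (pos c))
        (Equivalence.from (h _) v<k)) k≤i)) })

  record Within (l k : ℕ) (p p′ : Permutation′ n) : Set where
    field
      fixed : ∀ u → ¬ Block l k (p ⟨$⟩ʳ u) → p′ ⟨$⟩ʳ u ≡ p ⟨$⟩ʳ u
      stays : ∀ u → Block l k (p ⟨$⟩ʳ u) → Block l k (p′ ⟨$⟩ʳ u)

  block-dec : ∀ l k (i : Fin n) → Dec (Block l k i)
  block-dec l k i = (l ≤? toℕ i) ×-dec (toℕ i <? l + k)

  block? : ∀ l k (i : Fin n) → Block l k i ⊎ ¬ Block l k i
  block? l k i = toSum (block-dec l k i)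

  outside-precedes : ∀ l k {i j j′ : Fin n} → ¬ Block l k i → Block l k j → Block l k j′ →
    (toℕ i <ᵇ toℕ j) ≡ (toℕ i <ᵇ toℕ j′)
  outside-precedes l k {i} ¬i (a , b) (a′ , b′) with <-≤-connex (toℕ i) l
  ... | inj₁ i<l = trans (<⇒<ᵇ-true (<-≤-trans i<l a)) (sym (<⇒<ᵇ-true (<-≤-trans i<l a′)))
  ... | inj₂ l≤i with <-≤-connex (toℕ i) (l + k)
  ...   | inj₁ i<r = contradiction (l≤i , i<r) ¬i
  ...   | inj₂ r≤i = trans (≥⇒<ᵇ-false (<⇒≤ (<-≤-trans b r≤i))) (sym (≥⇒<ᵇ-false (<⇒≤ (<-≤-trans b′ r≤i))))

  <ᵇ-flip-Fin : {i j : Fin n} → i ≢ j → (toℕ j <ᵇ toℕ i) ≡ not (toℕ i <ᵇ toℕ j)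
  <ᵇ-flip-Fin i≢j = <ᵇ-flip (i≢j ∘ toℕ-injective)

  -- A rank outside an interval compares alike with all ranks in it, and the ranks that change stay
  -- in the interval.
  precedes-within : ∀ {l k p p′} → Within l k p p′ → ∀ u v →
    ¬ (Block l k (p ⟨$⟩ʳ u) × Block l k (p ⟨$⟩ʳ v)) → precedes p′ u v ≡ precedes p u v
  precedes-within {l} {k} {p} {p′} w u v ¬uv
    with block? l k (p ⟨$⟩ʳ u) | block? l k (p ⟨$⟩ʳ v)
  ... | inj₁ bu | inj₁ bv = contradiction (bu , bv) ¬uv
  ... | inj₂ ¬u | inj₂ ¬v = cong₂ (λ x y → toℕ x <ᵇ toℕ y) (Within.fixed w u ¬u) (Within.fixed w v ¬v)
  ... | inj₂ ¬u | inj₁ bv rewrite Within.fixed w u ¬u =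
        outside-precedes l k ¬u (Within.stays w v bv) bv
  ... | inj₁ bu | inj₂ ¬v rewrite Within.fixed w v ¬v = begin
        toℕ (p′ ⟨$⟩ʳ u) <ᵇ toℕ (p ⟨$⟩ʳ v)        ≡⟨ <ᵇ-flip-Fin (ne (Within.stays w u bu)) ⟩
        not (toℕ (p ⟨$⟩ʳ v) <ᵇ toℕ (p′ ⟨$⟩ʳ u))  ≡⟨ cong not (outside-precedes l k ¬v (Within.stays w u bu) bu) ⟩
        not (toℕ (p ⟨$⟩ʳ v) <ᵇ toℕ (p ⟨$⟩ʳ u))   ≡⟨ <ᵇ-flip-Fin (ne bu) ⟨
        toℕ (p ⟨$⟩ʳ u) <ᵇ toℕ (p ⟨$⟩ʳ v)         ∎
    where
    open ≡-Reasoning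
    ne : ∀ {i} → Block l k i → p ⟨$⟩ʳ v ≢ i
    ne b e = ¬v (subst (Block l k) (sym e) b)

  module _ {l k : ℕ} (l+k≤n : l + k ≤ n) (p q : Permutation′ n) where
    open RotatedBlock l k l+k≤n

    private
      p₁ = p ∘ₚ flip (rotate l)

    rotated-within : (∀ u → toℕ (p₁ ⟨$⟩ʳ u) < k → toℕ (q ⟨$⟩ʳ u) < k) →
                     (∀ u → k ≤ toℕ (p₁ ⟨$⟩ʳ u) → q ⟨$⟩ʳ u ≡ p₁ ⟨$⟩ʳ u) →
                     Within l k p (q ∘ₚ rotate l)
    rotated-within small large = record
      { fixed = λ u ¬b → trans (cong (rotate l ⟨$⟩ʳ_) (large u (unrotate-outer _ ¬b))) (inverseʳ (rotate l))
      ; stays = λ u b → rotate-block _ (small u (unrotate-inner _ b))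
      }

    rotated-precedes : (∀ u → toℕ (p₁ ⟨$⟩ʳ u) < k → toℕ (q ⟨$⟩ʳ u) < k) → ∀ u v →
      Block l k (p ⟨$⟩ʳ u) → Block l k (p ⟨$⟩ʳ v) →
      precedes (q ∘ₚ rotate l) u v ≡ precedes q u v
    rotated-precedes small u v bu bv = trans
      (cong₂ _<ᵇ_ (rotate-inner _ (small u (unrotate-inner _ bu))) (rotate-inner _ (small v (unrotate-inner _ bv))))
      (<ᵇ-+ l)

    unrotated-precedes : ∀ u v → Block l k (p ⟨$⟩ʳ u) → Block l k (p ⟨$⟩ʳ v) →
      precedes p u v ≡ precedes p₁ u v
    unrotated-precedes u v bu bv = trans
      (cong₂ _<ᵇ_ (unrotate-toℕ _ bu) (unrotate-toℕ _ bv)) (<ᵇ-+ l)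

  record Moved (l l′ k : ℕ) (c c′ : Configuration n) : Set where
    field
      equivalent : SpindleEquivalent (spindle c) (spindle c′)
      pos-within : Within l k (pos c) (pos c′)
      val-within : Within l′ k (val c) (val c′)

  module _ {l l′ k : ℕ} (l+k≤n : l + k ≤ n) (l′+k≤n : l′ + k ≤ n) (c : Configuration n)
    (block : ∀ u → Block l k (pos c ⟨$⟩ʳ u) ⇔ Block l′ k (val c ⟨$⟩ʳ u)) where

    private
      module L  = RotatedBlock l  k l+k≤n
      module L′ = RotatedBlock l′ k l′+k≤n
      c₁ = unrotated l l′ c

      small : ∀ u → toℕ (pos c₁ ⟨$⟩ʳ u) < k ⇔ toℕ (val c₁ ⟨$⟩ʳ u) < k
      small u = mk⇔
        (λ p<k → L′.unrotate-inner _ (Equivalence.to (block u)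
          (subst (Block l k) (inverseʳ (rotate l)) (L.rotate-block _ p<k))))
        (λ q<k → L.unrotate-inner _ (Equivalence.from (block u)
          (subst (Block l′ k) (inverseʳ (rotate l′)) (L′.rotate-block _ q<k))))

      start< : ∀ {m} → 0 < k → m + k ≤ n → m < n
      start< {m} 0<k m+k≤n = <-≤-trans (m<m+n m 0<k) m+k≤n

      -- The move takes place in `c₁`, where the block is initial in both orders; circular moves
      -- lead there and back.
      surround : ∀ c₂ → 0 < k → SpindleMove (spindle c₁) (spindle c₂) →
                 SpindleEquivalent (spindle c) (spindle (rotated l l′ c₂))
      surround c₂ 0<k move =
        Eq.transitive _ (unrotated-equivalent c (start< 0<k l+k≤n) (start< 0<k l′+k≤n))
          (Eq.transitive _ (Eq.return move)
            (rotated-equivalent c₂ (start< 0<k l+k≤n) (start< 0<k l′+k≤n)))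

    vertical-flip : 0 < k → ∃ λ c′ → Moved l l′ k c c′ × (∀ u v →
      Block l k (pos c ⟨$⟩ʳ u) → Block l k (pos c ⟨$⟩ʳ v) →
      precedes (pos c′) u v ≡ precedes (pos c) v u × precedes (val c′) u v ≡ precedes (val c) v u)
    vertical-flip 0<k = rotated l l′ c₂ ,
      record { equivalent = surround c₂ 0<k (vertical-move k k≤n 0<k stable λ i → refl)
             ; pos-within = rotated-within l+k≤n (pos c) (pos c₂) (stays (pos c₁)) (fixed (pos c₁))
             ; val-within = rotated-within l′+k≤n (val c) (val c₂) (stays (val c₁)) (fixed (val c₁)) } ,
      λ u v bu bv →
        trans (rotated-precedes l+k≤n (pos c) (pos c₂) (stays (pos c₁)) u v bu bv)
          (trans (reverses (pos c₁) u v (L.unrotate-inner _ bu) (L.unrotate-inner _ bv))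
            (sym (unrotated-precedes l+k≤n (pos c) (pos c₂) v u bv bu))) ,
        (let bu′ = Equivalence.to (block u) bu
             bv′ = Equivalence.to (block v) bv in
        trans (rotated-precedes l′+k≤n (val c) (val c₂) (stays (val c₁)) u v bu′ bv′)
          (trans (reverses (val c₁) u v (L′.unrotate-inner _ bu′) (L′.unrotate-inner _ bv′))
            (sym (unrotated-precedes l′+k≤n (val c) (val c₂) v u bv′ bu′))))
      where
      k≤n : k ≤ n
      k≤n = ≤-trans (m≤n+m k l) l+k≤n
      c₂ : Configuration n
      c₂ = ⟨ pos c₁ ∘ₚ reflect k k≤n , val c₁ ∘ₚ reflect k k≤n ⟩
      stable : ∀ i → toℕ i < k ⇔ toℕ (spindle c₁ ⟨$⟩ʳ i) < k
      stable i = subst (λ x → toℕ x < k ⇔ toℕ (spindle c₁ ⟨$⟩ʳ i) < k) (inverseʳ (pos c₁)) (small (pos c₁ ⟨$⟩ˡ i))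
      stays : ∀ (q : Permutation′ n) u → toℕ (q ⟨$⟩ʳ u) < k → toℕ (reflect k k≤n ⟨$⟩ʳ (q ⟨$⟩ʳ u)) < k
      stays q u q<k = subst (_< k) (sym (toℕ-reflect-< k k≤n _ q<k)) (k∸1+i<k q<k)
      fixed : ∀ (q : Permutation′ n) u → k ≤ toℕ (q ⟨$⟩ʳ u) → reflect k k≤n ⟨$⟩ʳ (q ⟨$⟩ʳ u) ≡ q ⟨$⟩ʳ u
      fixed q u = reflect-≥ k k≤n _
      reverses : ∀ (q : Permutation′ n) u v → toℕ (q ⟨$⟩ʳ u) < k → toℕ (q ⟨$⟩ʳ v) < k →
        precedes (q ∘ₚ reflect k k≤n) u v ≡ precedes q v u
      reverses q u v u<k v<k = trans
        (cong₂ _<ᵇ_ (toℕ-reflect-< k k≤n _ u<k) (toℕ-reflect-< k k≤n _ v<k)) (reflect-reverses u<k v<k)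

    horizontal-flip : 1 < k → ∃ λ c′ → Moved l l′ k c c′ × (∀ u v →
      Block l k (pos c ⟨$⟩ʳ u) → Block l k (pos c ⟨$⟩ʳ v) →
      precedes (pos c′) u v ≡ precedes (val c) u v × precedes (val c′) u v ≡ precedes (pos c) u v)
    horizontal-flip 1<k = rotated l l′ c₂ ,
      record { equivalent = surround c₂ (<⇒≤ 1<k) (horizontal-move k 1<k (≤-trans (m≤n+m k l) l+k≤n) c₁ small)
             ; pos-within = rotated-within l+k≤n (pos c) (pos c₂) pos-stays (exchange-≥ k (pos c₁) (val c₁) small)
             ; val-within = rotated-within l′+k≤n (val c) (val c₂) val-stays (exchange-≥ k (val c₁) (pos c₁) (⇔-sym ∘ small)) } ,
      λ u v bu bv →
        let bu′ = Equivalence.to (block u) bu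
            bv′ = Equivalence.to (block v) bv
            pos≡ = λ w b → cong toℕ (exchange-< k (pos c₁) (val c₁) small w (L.unrotate-inner _ b))
            val≡ = λ w b → cong toℕ (exchange-< k (val c₁) (pos c₁) (⇔-sym ∘ small) w (L′.unrotate-inner _ b)) in
        trans (rotated-precedes l+k≤n (pos c) (pos c₂) pos-stays u v bu bv)
          (trans (cong₂ _<ᵇ_ (pos≡ u bu) (pos≡ v bv))
            (sym (unrotated-precedes l′+k≤n (val c) (val c₂) u v bu′ bv′))) ,
        trans (rotated-precedes l′+k≤n (val c) (val c₂) val-stays u v bu′ bv′)
          (trans (cong₂ _<ᵇ_ (val≡ u bu′) (val≡ v bv′))
            (sym (unrotated-precedes l+k≤n (pos c) (pos c₂) u v bu bv)))
      where
      c₂ : Configuration n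
      c₂ = ⟨ exchange k (pos c₁) (val c₁) small , exchange k (val c₁) (pos c₁) (⇔-sym ∘ small) ⟩
      pos-stays : ∀ u → toℕ (pos c₁ ⟨$⟩ʳ u) < k → toℕ (pos c₂ ⟨$⟩ʳ u) < k
      pos-stays u p<k = subst (λ x → toℕ x < k) (sym (exchange-< k (pos c₁) (val c₁) small u p<k)) (Equivalence.to (small u) p<k)
      val-stays : ∀ u → toℕ (val c₁ ⟨$⟩ʳ u) < k → toℕ (val c₂ ⟨$⟩ʳ u) < k
      val-stays u q<k = subst (λ x → toℕ x < k) (sym (exchange-< k (val c₁) (pos c₁) (⇔-sym ∘ small) u q<k)) (Equivalence.from (small u) q<k)

-- Blocks of positions that are also blocks of values.

least : ∀ {P : ℕ → Set} → (∀ i → Dec (P i)) → ∀ {m} → P m → ∃ λ j → P j × (∀ i → i < j → ¬ P i)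
least {P} P? {m} = go m (<-wellFounded m)
  where
  go : ∀ m → Acc _<_ m → P m → ∃ λ j → P j × (∀ i → i < j → ¬ P i)
  go m (acc rec) pm with range-search {P = λ i → ¬ P i} {Q = ∃ λ i → i < m × P i} 0 m
                           (λ i _ i<m → case P? i of λ where
                             (yes p) → inj₂ (i , i<m , p)
                             (no ¬p) → inj₁ ¬p)
  ... | inj₁ none          = m , pm , λ i → none i z≤n
  ... | inj₂ (i , i<m , p) = go i (rec i<m) p

module _ {n : ℕ} .{{_ : NonZero n}} where

  mod-toℕ : ∀ {i : Fin n} {m} → toℕ i ≡ m → m mod n ≡ i
  mod-toℕ {i} refl = toℕ-injective (toℕ-mod-< (toℕ<n i))

  -- Pigeonhole: the map from the offset of a vertex in the first block to its offset in the second
  -- is injective.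
  block-card-≤ : ∀ {l k l′ k′} (p q : Permutation′ n) → l + k ≤ n →
    (∀ u → Block l k (p ⟨$⟩ʳ u) → Block l′ k′ (q ⟨$⟩ʳ u)) → k ≤ k′
  block-card-≤ {l} {k} {l′} {k′} p q l+k≤n sub = injective⇒≤ {f = f} f-injective
    where
    u : Fin k → Fin n
    u x = p ⟨$⟩ˡ ((l + toℕ x) mod n)
    pu : ∀ x → toℕ (p ⟨$⟩ʳ u x) ≡ l + toℕ x
    pu x = trans (cong toℕ (inverseʳ p)) (toℕ-mod-< (<-≤-trans (+-monoʳ-< l (toℕ<n x)) l+k≤n))
    b : ∀ x → Block l′ k′ (q ⟨$⟩ʳ u x)
    b x = sub (u x) (subst (l ≤_) (sym (pu x)) (m≤m+n l _)
                    , subst (_< l + k) (sym (pu x)) (+-monoʳ-< l (toℕ<n x)))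
    bound : ∀ x → toℕ (q ⟨$⟩ʳ u x) ∸ l′ < k′
    bound x = subst (toℕ (q ⟨$⟩ʳ u x) ∸ l′ <_) (m+n∸m≡n l′ k′) (∸-monoˡ-< (proj₂ (b x)) (proj₁ (b x)))
    f : Fin k → Fin k′
    f x = fromℕ< (bound x)
    f-injective : ∀ {x y} → f x ≡ f y → x ≡ y
    f-injective {x} {y} eq = toℕ-injective (+-cancelˡ-≡ l _ _ (begin
      l + toℕ x             ≡⟨ pu x ⟨
      toℕ (p ⟨$⟩ʳ u x)      ≡⟨ cong (λ u → toℕ (p ⟨$⟩ʳ u)) (⟨$⟩ʳ-injective q (toℕ-injective
                                 (∸-cancelʳ-≡ (proj₁ (b x)) (proj₁ (b y))
                                   (trans (sym (toℕ-fromℕ< (bound x))) (trans (cong toℕ eq) (toℕ-fromℕ< (bound y))))))) ⟩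
      toℕ (p ⟨$⟩ʳ u y)      ≡⟨ pu y ⟩
      l + toℕ y             ∎))
      where open ≡-Reasoning

  module _ {l k : ℕ} (p q : Permutation′ n) where

    private
      In : Fin n → Set
      In u = Block l k (p ⟨$⟩ʳ u)

      Occupied : ℕ → Set
      Occupied i = ∃ λ u → toℕ (q ⟨$⟩ʳ u) ≡ i × In u

      -- The alternative `n ≤ i` ensures that a least free rank exists even when the occupied ranks
      -- reach the end.
      Free : ℕ → ℕ → Set
      Free l′ i = n ≤ i ⊎ (l′ ≤ i × ¬ Occupied i)

      at : ∀ {i} → i < n → ∃ λ u → toℕ (q ⟨$⟩ʳ u) ≡ i
      at i<n = q ⟨$⟩ˡ fromℕ< i<n , trans (cong toℕ (inverseʳ q)) (toℕ-fromℕ< i<n)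

      occupied? : ∀ i → Dec (Occupied i)
      occupied? i with i <? n
      ... | no i≮n = no λ (u , eq , _) → i≮n (subst (_< n) eq (toℕ<n _))
      ... | yes i<n with at i<n
      ...   | u , eq with block-dec l k (p ⟨$⟩ʳ u)
      ...     | yes b = yes (u , eq , b)
      ...     | no ¬b = no λ (v , eq′ , b) → ¬b (subst In
                  (⟨$⟩ʳ-injective q (toℕ-injective (trans eq′ (sym eq)))) b)

    -- An element ranked beyond the first free rank `r′` would leave an outside vertex at `r′` that
    -- follows `u₀` and precedes this element, against homogeneity. So the elements fill `[l′,r′)`,
    -- and counting in both directions gives the length.
    block-from-ends : ∀ {l′ r′} → l + k ≤ n →
      (∀ w u v → ¬ In w → In u → In v → precedes q w u ≡ precedes q w v) →
      Occupied l′ → (∀ i → i < l′ → ¬ Occupied i) →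
      Free l′ r′ → (∀ i → i < r′ → ¬ Free l′ i) →
      l′ + k ≤ n × (∀ u → In u ⇔ Block l′ k (q ⟨$⟩ʳ u))
    block-from-ends {l′} {r′} l+k≤n hom (u₀ , eq₀ , b₀) below free not-free =
      subst (λ x → l′ + x ≤ n) (sym k≡k′) l′+k′≤n ,
      λ u → subst (λ x → In u ⇔ Block l′ x (q ⟨$⟩ʳ u)) (sym k≡k′) (mk⇔ (to u) (from u))
      where
      k′ = r′ ∸ l′

      r′≤n : r′ ≤ n
      r′≤n = ≮⇒≥ λ n<r′ → not-free n n<r′ (inj₁ ≤-refl)

      l′<r′ : l′ < r′
      l′<r′ = case free of λ where
        (inj₁ n≤r′) → <-≤-trans (subst (_< n) eq₀ (toℕ<n _)) n≤r′
        (inj₂ (l′≤r′ , ¬occ)) → ≤∧≢⇒< l′≤r′ λ eq → ¬occ (u₀ , trans eq₀ eq , b₀)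

      l′+k′≡r′ : l′ + k′ ≡ r′
      l′+k′≡r′ = m+[n∸m]≡n (<⇒≤ l′<r′)

      l′+k′≤n : l′ + k′ ≤ n
      l′+k′≤n = subst (_≤ n) (sym l′+k′≡r′) r′≤n

      from : ∀ u → Block l′ k′ (q ⟨$⟩ʳ u) → In u
      from u (l′≤ , <r′) = case occupied? (toℕ (q ⟨$⟩ʳ u)) of λ where
        (yes (v , eq , b)) → subst In (⟨$⟩ʳ-injective q (toℕ-injective eq)) b
        (no ¬occ) → contradiction (inj₂ (l′≤ , ¬occ)) (not-free _ (subst (_ <_) l′+k′≡r′ <r′))

      below-r′ : ∀ u → In u → toℕ (q ⟨$⟩ʳ u) < r′
      below-r′ u b = ≰⇒> λ r′≤qu → case free of λ where
          (inj₁ n≤r′) → <⇒≱ (toℕ<n (q ⟨$⟩ʳ u)) (≤-trans n≤r′ r′≤qu)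
          (inj₂ (l′≤r′ , ¬occ)) → let
              w , qw = at (≤-<-trans r′≤qu (toℕ<n (q ⟨$⟩ʳ u)))
              r′<qu = ≤∧≢⇒< r′≤qu λ eq → ¬occ (u , sym eq , b)
            in case trans (sym (≥⇒<ᵇ-false (subst₂ _≤_ (sym eq₀) (sym qw) l′≤r′)))
                 (trans (hom w u₀ u (λ bw → ¬occ (w , qw , bw)) b₀ b)
                        (<⇒<ᵇ-true (subst (_< _) (sym qw) r′<qu))) of λ ()

      to : ∀ u → In u → Block l′ k′ (q ⟨$⟩ʳ u)
      to u b = ≮⇒≥ (λ lt → below _ lt (u , refl , b))
             , subst (_ <_) (sym l′+k′≡r′) (below-r′ u b)

      k≡k′ : k ≡ k′
      k≡k′ = ≤-antisym (block-card-≤ p q l+k≤n to) (block-card-≤ q p l′+k′≤n from)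

    -- The ranks q of a p-block whose elements all compare alike with every outside
    -- element again form a block: they have no gaps, and its length is forced.

    homogeneous⇒block : 0 < k → l + k ≤ n →
      (∀ w u v → ¬ In w → In u → In v → precedes q w u ≡ precedes q w v) →
      ∃ λ l′ → l′ + k ≤ n × (∀ u → In u ⇔ Block l′ k (q ⟨$⟩ʳ u))
    homogeneous⇒block 0<k l+k≤n hom with least occupied? {toℕ (q ⟨$⟩ʳ u₀)} (u₀ , refl , b₀)
      where
      u₀ : Fin n
      u₀ = p ⟨$⟩ˡ (l mod n)
      b₀ : In u₀
      b₀ = subst (λ x → l ≤ x × x < l + k)
        (sym (trans (cong toℕ (inverseʳ p)) (toℕ-mod-< (<-≤-trans (m<m+n l 0<k) l+k≤n))))
        (≤-refl , m<m+n l 0<k)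
    ... | l′ , occ , below
      with least {P = Free l′} (λ i → (n ≤? i) ⊎-dec ((l′ ≤? i) ×-dec ¬? (occupied? i))) {n} (inj₁ ≤-refl)
    ... | r′ , free , not-free = l′ , block-from-ends l+k≤n hom occ below free not-free

  edge : Configuration n → Fin n → Fin n → Bool
  edge c u v = precedes (pos c) u v xor precedes (val c) u v

  precedes-xor-sym : ∀ (p q : Permutation′ n) u v →
    precedes p u v xor precedes q u v ≡ precedes p v u xor precedes q v u
  precedes-xor-sym p q u v = <ᵇ-xor-sym (toℕ (p ⟨$⟩ʳ u)) _ (toℕ (q ⟨$⟩ʳ u)) _
    (λ eq → cong (λ x → toℕ (q ⟨$⟩ʳ x)) (⟨$⟩ʳ-injective p (toℕ-injective eq)))
    (λ eq → cong (λ x → toℕ (p ⟨$⟩ʳ x)) (⟨$⟩ʳ-injective q (toℕ-injective eq)))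

  precedes-flip : ∀ (p : Permutation′ n) {u v} → u ≢ v → precedes p v u ≡ not (precedes p u v)
  precedes-flip p u≢v = <ᵇ-flip-Fin (u≢v ∘ ⟨$⟩ʳ-injective p)

  within-block : ∀ {l k} {p p′ : Permutation′ n} → Within l k p p′ → ∀ u →
    Block l k (p′ ⟨$⟩ʳ u) → Block l k (p ⟨$⟩ʳ u)
  within-block {l} {k} {p} w u b with block? l k (p ⟨$⟩ʳ u)
  ... | inj₁ b′ = b′
  ... | inj₂ ¬b = subst (Block l k) (Within.fixed w u ¬b) b

  within-trans : ∀ {l k} {p p′ p″ : Permutation′ n} → Within l k p p′ → Within l k p′ p″ → Within l k p p″
  within-trans w w′ = record
    { fixed = λ u ¬b → trans (Within.fixed w′ u (¬b ∘ within-block w u)) (Within.fixed w u ¬b)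
    ; stays = λ u → Within.stays w′ u ∘ Within.stays w u
    }

  within-mono : ∀ {x j l k} {p p′ : Permutation′ n} → l ≤ x → x + j ≤ l + k → Within x j p p′ → Within l k p p′
  within-mono {x} {j} {l} {k} {p} {p′} l≤x x+j≤l+k w = record
    { fixed = λ u ¬b → Within.fixed w u (¬b ∘ embed)
    ; stays = stays
    }
    where
    embed : ∀ {i : Fin n} → Block x j i → Block l k i
    embed (a , b) = ≤-trans l≤x a , <-≤-trans b x+j≤l+k
    stays : ∀ u → Block l k (p ⟨$⟩ʳ u) → Block l k (p′ ⟨$⟩ʳ u)
    stays u b with block? x j (p ⟨$⟩ʳ u)
    ... | inj₁ b′ = embed (Within.stays w u b′)
    ... | inj₂ ¬b = subst (Block l k) (sym (Within.fixed w u ¬b)) b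

  -- Reflections of blocks in configurations with a given graph.

  module Sorting (t : Configuration n) where

    -- The configurations with the graph of the target `t`. Only their position order has to be
    -- brought to that of `t`: position order and graph together determine the value order.
    record State : Set where
      field
        conf : Configuration n
        edge-≡ : ∀ u v → edge conf u v ≡ edge t u v

    open State public

    position : State → Fin n → Fin n
    position s u = pos (conf s) ⟨$⟩ʳ u

    bad : State → Fin n → Fin n → Bool
    bad s u v = precedes (pos (conf s)) u v xor precedes (pos t) u v

    bad-sym : ∀ s u v → bad s u v ≡ bad s v u
    bad-sym s = precedes-xor-sym (pos (conf s)) (pos t)

    bad-irrefl : ∀ s u → bad s u u ≡ false
    bad-irrefl s u rewrite <ᵇ-irrefl (toℕ (position s u)) = <ᵇ-irrefl (toℕ (pos t ⟨$⟩ʳ u))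

    record Step (l k : ℕ) (s s′ : State) : Set where
      field
        equivalent : SpindleEquivalent (spindle (conf s)) (spindle (conf s′))
        within : Within l k (pos (conf s)) (pos (conf s′))

    open Step public

    step-trans : ∀ {l k s s′ s″} → Step l k s s′ → Step l k s′ s″ → Step l k s s″
    step-trans f g = record
      { equivalent = Eq.transitive _ (equivalent f) (equivalent g)
      ; within = within-trans (within f) (within g)
      }

    step-refl : ∀ {l k s} → Step l k s s
    step-refl = record
      { equivalent = Eq.reflexive _
      ; within = record { fixed = λ _ _ → refl ; stays = λ _ b → b }
      }

    step-mono : ∀ {x j l k s s′} → l ≤ x → x + j ≤ l + k → Step x j s s′ → Step l k s s′
    step-mono l≤x x+j≤l+k f = record
      { equivalent = equivalent f
      ; within = within-mono l≤x x+j≤l+k (within f)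
      }

    bad-outside : ∀ {l k s s′} → Step l k s s′ → ∀ u v →
      ¬ (Block l k (position s u) × Block l k (position s v)) → bad s′ u v ≡ bad s u v
    bad-outside f u v ¬uv = cong (_xor precedes (pos t) u v) (precedes-within (within f) u v ¬uv)

    -- The vertices in the block form a module of the graph of `t`. This is what makes their values
    -- a block as well, so that a reflection applies.
    Homog : ℕ → ℕ → State → Set
    Homog l k s = ∀ w u v → ¬ Block l k (position s w) → Block l k (position s u) → Block l k (position s v) →
                  edge t w u ≡ edge t w v

    homog-step : ∀ {l k s s′} → Step l k s s′ → Homog l k s → Homog l k s′
    homog-step f hom w u v ¬bw bu bv =
      hom w u v (¬bw ∘ Within.stays (within f) w) (within-block (within f) u bu) (within-block (within f) v bv)

    module _ {l k : ℕ} (s : State) where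

      private
        c = conf s

        In : Fin n → Set
        In u = Block l k (position s u)

      -- An outside vertex compares alike in position with the whole block; cancelling this from
      -- equal edges leaves equal comparisons of values.
      val-homogeneous : Homog l k s → ∀ w u v → ¬ In w → In u → In v →
                        precedes (val c) w u ≡ precedes (val c) w v
      val-homogeneous hom w u v ¬bw bu bv = xor-cancelˡ (precedes (pos c) w u) (begin
        edge c w u  ≡⟨ edge-≡ s w u ⟩
        edge t w u  ≡⟨ hom w u v ¬bw bu bv ⟩
        edge t w v  ≡⟨ edge-≡ s w v ⟨
        edge c w v  ≡⟨ cong (_xor precedes (val c) w v) (outside-precedes l k ¬bw bu bv) ⟨
        precedes (pos c) w u xor precedes (val c) w v  ∎)
        where open ≡-Reasoning

      -- Pairs not contained in the block keep both comparisons, so the graph has to be checked on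
      -- `inner` pairs only.
      move-state : ∀ {l′ c′} → (∀ u → In u ⇔ Block l′ k (val c ⟨$⟩ʳ u)) → Moved l l′ k c c′ →
        (∀ u v → In u → In v → edge c′ u v ≡ edge c u v) → State
      move-state {c′ = c′} block moved inner = record { conf = c′ ; edge-≡ = edge-≡′ }
        where
        edge-≡′ : ∀ u v → edge c′ u v ≡ edge t u v
        edge-≡′ u v = trans (case (block? l k (position s u) , block? l k (position s v)) of λ where
          (inj₁ bu , inj₁ bv) → inner u v bu bv
          (inj₂ ¬b , _) → cong₂ _xor_
              (precedes-within (Moved.pos-within moved) u v (¬b ∘ proj₁))
              (precedes-within (Moved.val-within moved) u v (¬b ∘ Equivalence.from (block u) ∘ proj₁))
          (_ , inj₂ ¬b) → cong₂ _xor_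
              (precedes-within (Moved.pos-within moved) u v (¬b ∘ proj₂))
              (precedes-within (Moved.val-within moved) u v (¬b ∘ Equivalence.from (block v) ∘ proj₂)))
          (edge-≡ s u v)

      vertical-step : 0 < k → l + k ≤ n → Homog l k s → ∃ λ s′ → Step l k s s′ ×
        (∀ u v → In u → In v → u ≢ v → bad s′ u v ≡ not (bad s u v))
      vertical-step 0<k l+k≤n hom =
        let l′ , l′+k≤n , block = homogeneous⇒block (pos c) (val c) 0<k l+k≤n (val-homogeneous hom)
        in  finish block (vertical-flip l+k≤n l′+k≤n c block 0<k)
        where
        finish : ∀ {l′} → (∀ u → In u ⇔ Block l′ k (val c ⟨$⟩ʳ u)) →
          (∃ λ c′ → Moved l l′ k c c′ × (∀ u v → In u → In v →
            precedes (pos c′) u v ≡ precedes (pos c) v u × precedes (val c′) u v ≡ precedes (val c) v u)) →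
          ∃ λ s′ → Step l k s s′ × (∀ u v → In u → In v → u ≢ v → bad s′ u v ≡ not (bad s u v))
        finish block (c′ , moved , reverses) =
          move-state block moved (λ u v bu bv →
            trans (cong₂ _xor_ (proj₁ (reverses u v bu bv)) (proj₂ (reverses u v bu bv)))
                  (precedes-xor-sym (pos c) (val c) v u)) ,
          record { equivalent = Moved.equivalent moved ; within = Moved.pos-within moved } ,
          λ u v bu bv u≢v → trans
            (cong (_xor precedes (pos t) u v) (trans (proj₁ (reverses u v bu bv)) (precedes-flip (pos c) u≢v)))
            (sym (Boolₚ.not-distribˡ-xor (precedes (pos c) u v) _))

      horizontal-step : 1 < k → l + k ≤ n → Homog l k s → ∃ λ s′ → Step l k s s′ ×
        (∀ u v → In u → In v → bad s′ u v ≡ edge t u v xor bad s u v)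
      horizontal-step 1<k l+k≤n hom =
        let l′ , l′+k≤n , block = homogeneous⇒block (pos c) (val c) (<⇒≤ 1<k) l+k≤n (val-homogeneous hom)
        in  finish block (horizontal-flip l+k≤n l′+k≤n c block 1<k)
        where
        -- Here `a`, `b` and `x` are the comparisons in `pos c`, `val c` and `pos t`: the new bad
        -- bit is `b xor x`, the edge `a xor b` and the old bad bit `a xor x`.
        telescope : ∀ a b x → b xor x ≡ (a xor b) xor (a xor x)
        telescope true  b x = sym (Boolₚ.xor-annihilates-not b x)
        telescope false b x = refl
        finish : ∀ {l′} → (∀ u → In u ⇔ Block l′ k (val c ⟨$⟩ʳ u)) →
          (∃ λ c′ → Moved l l′ k c c′ × (∀ u v → In u → In v →
            precedes (pos c′) u v ≡ precedes (val c) u v × precedes (val c′) u v ≡ precedes (pos c) u v)) →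
          ∃ λ s′ → Step l k s s′ × (∀ u v → In u → In v → bad s′ u v ≡ edge t u v xor bad s u v)
        finish block (c′ , moved , swaps) =
          move-state block moved (λ u v bu bv →
            trans (cong₂ _xor_ (proj₁ (swaps u v bu bv)) (proj₂ (swaps u v bu bv)))
                  (Boolₚ.xor-comm (precedes (val c) u v) _)) ,
          record { equivalent = Moved.equivalent moved ; within = Moved.pos-within moved } ,
          λ u v bu bv → trans
            (cong (_xor precedes (pos t) u v) (proj₁ (swaps u v bu bv)))
            (trans (telescope (precedes (pos c) u v) (precedes (val c) u v) _)
                   (cong (_xor bad s u v) (edge-≡ s u v)))

-- Sorting by reflections of blocks

<-end : ∀ {x y z} → x ≤ y → z < y → z < x + (y ∸ x)
<-end x≤y = subst (_ <_) (sym (m+[n∸m]≡n x≤y))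

module Sorted {n : ℕ} .{{_ : NonZero n}} (t : Configuration n) where
  open Sorting t

  vertex : State → ℕ → Fin n
  vertex s i = pos (conf s) ⟨$⟩ˡ (i mod n)

  vertex-toℕ : ∀ s u → vertex s (toℕ (position s u)) ≡ u
  vertex-toℕ s u = trans (cong (pos (conf s) ⟨$⟩ˡ_) (mod-toℕ refl)) (inverseˡ (pos (conf s)))

  toℕ-vertex : ∀ s {i} → i < n → toℕ (position s (vertex s i)) ≡ i
  toℕ-vertex s i<n = trans (cong toℕ (inverseʳ (pos (conf s)))) (toℕ-mod-< i<n)

  colour : State → Fin n → Fin n → Colour
  colour s u v = edge t u v , bad s u v

  colour-sym : ∀ s u v → colour s u v ≡ colour s v u
  colour-sym s u v = cong₂ _,_ (precedes-xor-sym (pos t) (val t) u v) (bad-sym s u v)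

  convex-cong : ∀ {x y z x′ y′ z′} → x ≡ x′ → y ≡ y′ → z ≡ z′ → Convex x′ y′ z′ → Convex x y z
  convex-cong refl refl refl c = c

  -- On pairs in position order the edge bit, the bad bit and their sum are the complements of the
  -- comparisons in `val (conf s)`, `pos t` and `val t`. All three are therefore convex, and
  -- `convex-colours` applies.
  colour-between : ∀ s {u v w} → precedes (pos (conf s)) u v ≡ true → precedes (pos (conf s)) v w ≡ true →
                   colour s u w ≡ colour s u v ⊎ colour s u w ≡ colour s v w
  colour-between s {u} {v} {w} uv vw = convex-colours
    (convex-cong (edge-not uv) (edge-not vw) (edge-not uw) (convex-precedes (val (conf s))))
    (convex-cong (bad-not uv) (bad-not vw) (bad-not uw) (convex-precedes (pos t)))
    (convex-cong (sum-not uv) (sum-not vw) (sum-not uw) (convex-precedes (val t)))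
    where
    uw : precedes (pos (conf s)) u w ≡ true
    uw = trans (<ᵇ-convex (toℕ (position s u)) _ (toℕ (position s w)) (trans uv (sym vw))) uv
    convex-precedes : ∀ (p : Permutation′ n) →
      Convex (not (precedes p u v)) (not (precedes p v w)) (not (precedes p u w))
    convex-precedes p = convex-not (<ᵇ-convex (toℕ (p ⟨$⟩ʳ u)) _ (toℕ (p ⟨$⟩ʳ w)))
    edge-not : ∀ {x y} → precedes (pos (conf s)) x y ≡ true → edge t x y ≡ not (precedes (val (conf s)) x y)
    edge-not {x} {y} e = trans (sym (edge-≡ s x y)) (cong (_xor precedes (val (conf s)) x y) e)
    bad-not : ∀ {x y} → precedes (pos (conf s)) x y ≡ true → bad s x y ≡ not (precedes (pos t) x y)
    bad-not {x} {y} e = cong (_xor precedes (pos t) x y) e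
    cancel : ∀ a b → (a xor b) xor not a ≡ not b
    cancel true  b = Boolₚ.xor-identityʳ (not b)
    cancel false b = Boolₚ.xor-comm b true
    sum-not : ∀ {x y} → precedes (pos (conf s)) x y ≡ true → edge t x y xor bad s x y ≡ not (precedes (val t) x y)
    sum-not {x} {y} e = trans (cong (edge t x y xor_) (bad-not {x} {y} e)) (cancel (precedes (pos t) x y) _)

  col : State → ℕ → ℕ → Colour
  col s i j = colour s (vertex s i) (vertex s j)

  module Col (s : State) = Colouring n (col s) (λ i j → colour-sym s (vertex s i) (vertex s j))
    (λ i<j j<k k<n → colour-between s
       (subst₂ (λ x y → (x <ᵇ y) ≡ true) (sym (toℕ-vertex s (<-trans i<j (<-trans j<k k<n)))) (sym (toℕ-vertex s (<-trans j<k k<n))) (<⇒<ᵇ-true i<j))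
       (subst₂ (λ x y → (x <ᵇ y) ≡ true) (sym (toℕ-vertex s (<-trans j<k k<n))) (sym (toℕ-vertex s k<n)) (<⇒<ᵇ-true j<k)))

  col-position : ∀ s u v → col s (toℕ (position s u)) (toℕ (position s v)) ≡ colour s u v
  col-position s u v = cong₂ (colour s) (vertex-toℕ s u) (vertex-toℕ s v)

  vertex-block : ∀ s {l k i} → l + k ≤ n → l ≤ i → i < l + k → Block l k (position s (vertex s i))
  vertex-block s {l} {k} l+k≤n l≤i i<r =
    subst (λ x → l ≤ x × x < l + k) (sym (toℕ-vertex s (<-≤-trans i<r l+k≤n))) (l≤i , i<r)

  Good : ℕ → ℕ → State → Set
  Good l k s = ∀ u v → Block l k (position s u) → Block l k (position s v) → bad s u v ≡ false

  Result : ℕ → ℕ → State → Set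
  Result l k s = ∃ λ s′ → Step l k s s′ × Good l k s′

  result-after : ∀ {l k s s′} → Step l k s s′ → Result l k s′ → Result l k s
  result-after step (s″ , step′ , good) = s″ , step-trans step step′ , good

  -- The statement proved by induction on the length. It ranges over all states because sorting one
  -- part of a block changes the state for the next.
  Fixable : ℕ → Set
  Fixable k = ∀ l s → l + k ≤ n → Homog l k s → Result l k s

  -- A module of a module is a module: `hom` deals with the vertices outside the large block,
  -- `inner` with those inside it.
  sub-homogeneous : ∀ s {l k x y} → x ≤ y → Homog l k s → Col.Homogeneous s l (l + k) x y →
                    l ≤ x → y ≤ l + k → Homog x (y ∸ x) s
  sub-homogeneous s {l} {k} {x} {y} x≤y hom inner l≤x y≤r w u v ¬bw (x≤u , u<y) (x≤v , v<y) =
    case block? l k (position s w) of λ where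
      (inj₂ ¬b) → hom w u v ¬b (widen (x≤u , u<y)) (widen (x≤v , v<y))
      (inj₁ (l≤w , w<r)) → trans (sym (cong proj₁ (col-position s w u)))
        (trans (inner _ _ _ l≤w w<r outside x≤u (subst (_ <_) x+ u<y) x≤v (subst (_ <_) x+ v<y))
               (cong proj₁ (col-position s w v)))
    where
    x+ : x + (y ∸ x) ≡ y
    x+ = m+[n∸m]≡n x≤y
    widen : ∀ {i : Fin n} → Block x (y ∸ x) i → Block l k i
    widen (a , b) = ≤-trans l≤x a , <-≤-trans b (subst (_≤ l + k) (sym x+) y≤r)
    outside : Col.Outside s x y (toℕ (position s w))
    outside with <-≤-connex (toℕ (position s w)) x | <-≤-connex (toℕ (position s w)) y
    ... | inj₁ w<x | _        = inj₁ w<x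
    ... | _        | inj₂ y≤w = inj₂ y≤w
    ... | inj₂ x≤w | inj₁ w<y = contradiction (x≤w , subst (_ <_) (sym x+) w<y) ¬bw

  -- The cut is a predicate on vertices instead of a position, so that it survives the reordering of
  -- the block.
  GoodCut : (Fin n → Bool) → ℕ → ℕ → State → Set
  GoodCut P l k s = ∀ u v → Block l k (position s u) → Block l k (position s v) → P u ≢ P v → bad s u v ≡ false

  Splits : (Fin n → Bool) → ℕ → ℕ → State → Set
  Splits P l k s = ∃₂ λ u v → Block l k (position s u) × Block l k (position s v) × P u ≢ P v

  record Improves (l k : ℕ) (s s′ : State) : Set where
    field
      step : Step l k s s′
      keeps-good : ∀ u v → bad s u v ≡ false → bad s′ u v ≡ false

  open Improves public

  good-cut-step : ∀ {P l k s s′} → Improves l k s s′ → GoodCut P l k s → GoodCut P l k s′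
  good-cut-step i cut u v bu bv P≢ = keeps-good i u v
    (cut u v (within-block (within (step i)) u bu) (within-block (within (step i)) v bv) P≢)

  splits-step : ∀ {P l k s s′} → Step l k s s′ → Splits P l k s → Splits P l k s′
  splits-step f (u , v , bu , bv , P≢) =
    u , v , Within.stays (within f) u bu , Within.stays (within f) v bv , P≢

  -- Sorting a homogeneous proper subinterval spoils no pair: pairs inside it become good and all
  -- others keep their comparison.
  fix-sub : ∀ {l k} s x y → x < y → l ≤ x → y ≤ l + k → l + k ≤ n → l < x ⊎ y < l + k →
    (∀ {j} → j < k → Fixable j) → Homog l k s → Col.Homogeneous s l (l + k) x y →
    ∃ λ s′ → Improves l k s s′ × Good x (y ∸ x) s′ × Step x (y ∸ x) s s′
  fix-sub {l} {k} s x y x<y l≤x y≤r r≤n proper rec hom inner =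
    let s′ , f , good = rec shorter x s (subst (_≤ n) (sym x+) (≤-trans y≤r r≤n))
                          (sub-homogeneous s (<⇒≤ x<y) hom inner l≤x y≤r)
    in  s′ , record { step = step-mono l≤x (subst (_≤ l + k) (sym x+) y≤r) f ; keeps-good = keeps f good } , good , f
    where
    x+ : x + (y ∸ x) ≡ y
    x+ = m+[n∸m]≡n (<⇒≤ x<y)
    shorter : y ∸ x < k
    shorter = +-cancelˡ-< x _ _ (subst (_< x + k) (sym x+) (case proper of λ where
      (inj₁ l<x) → ≤-<-trans y≤r (+-monoˡ-< k l<x)
      (inj₂ y<r) → <-≤-trans y<r (+-monoˡ-≤ k l≤x)))
    keeps : ∀ {s′} → Step x (y ∸ x) s s′ → Good x (y ∸ x) s′ → ∀ u v → bad s u v ≡ false → bad s′ u v ≡ false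
    keeps f good u v g with block? x (y ∸ x) (position s u) | block? x (y ∸ x) (position s v)
    ... | inj₁ bu | inj₁ bv = good u v (Within.stays (within f) u bu) (Within.stays (within f) v bv)
    ... | inj₂ ¬b | _       = trans (bad-outside f u v (¬b ∘ proj₁)) g
    ... | _       | inj₂ ¬b = trans (bad-outside f u v (¬b ∘ proj₂)) g

  module _ {l k : ℕ} (r≤n : l + k ≤ n) (rec : ∀ {j} → j < k → Fixable j) where

    private
      r = l + k

    -- The two sides of `P` need not be intervals of positions. Wherever `P` changes along the
    -- positions, `change⇒cut` yields a prefix cut that no bad pair crosses.
    position-cut : ∀ P s → GoodCut P l k s → Splits P l k s →
                   ∃ λ j → l ≤ j × suc j < r × Col.Cut s second false l (suc j) r
    position-cut P s cut (u , v , bu , bv , P≢)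
      with constant-or-change Boolₚ._≟_ (P ∘ vertex s) l r
    ... | inj₁ const = contradiction
            (trans (cong P (sym (vertex-toℕ s u))) (trans (const _ (proj₁ bu) (proj₂ bu))
              (trans (sym (const _ (proj₁ bv) (proj₂ bv))) (cong P (vertex-toℕ s v))))) P≢
    ... | inj₂ (j , l≤j , 1+j<r , dj≢) = j , l≤j , 1+j<r ,
            Col.change⇒cut s Boolₚ._≟_ (P ∘ vertex s) second false l r r≤n
              (λ p q l≤p p<q q<r → cut _ _ (vertex-block s r≤n l≤p (<-trans p<q q<r))
                                           (vertex-block s r≤n (≤-trans l≤p (<⇒≤ p<q)) q<r))
              1+j<r dj≢

    -- The bad pair lies on one side of the position cut, and this side is closed.
    -- `homogeneous-interval` shrinks it to a homogeneous interval around the pair, which is shorter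
    -- than the block and can be sorted by `rec`.
    repair-ordered : ∀ P s → Homog l k s → GoodCut P l k s → Splits P l k s → ∀ u v →
      Block l k (position s u) → Block l k (position s v) → toℕ (position s u) < toℕ (position s v) →
      bad s u v ≡ true → ∃ λ s′ → Improves l k s s′ × bad s′ u v ≡ false
    repair-ordered P s hom cut splits u v (l≤u , u<r) (l≤v , v<r) u<v buv =
      from-cut (position-cut P s cut splits)
      where
      pu = toℕ (position s u)
      pv = toℕ (position s v)

      col-bad : proj₂ (col s pu pv) ≡ true
      col-bad = trans (cong proj₂ (col-position s u v)) buv

      from-interval : ∀ {x y} → l ≤ x → y ≤ r → l < x ⊎ y < r →
        (∃₂ λ x′ y′ → x ≤ x′ × x′ ≤ pu × pv < y′ × y′ ≤ y × Col.Homogeneous s l r x′ y′) →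
        ∃ λ s′ → Improves l k s s′ × bad s′ u v ≡ false
      from-interval l≤x y≤r proper (x′ , y′ , x≤x′ , x′≤u , v<y′ , y′≤y , inner) =
        let x′<y′ = ≤-<-trans x′≤u (<-trans u<v v<y′)
            s′ , i , good , f = fix-sub s x′ y′ x′<y′ (≤-trans l≤x x≤x′) (≤-trans y′≤y y≤r) r≤n
              ([ (λ l<x → inj₁ (<-≤-trans l<x x≤x′)) , (λ y<r → inj₂ (≤-<-trans y′≤y y<r)) ]′ proper) rec hom inner
        in  s′ , i , good u v
              (Within.stays (within f) u (x′≤u , <-end (<⇒≤ x′<y′) (<-trans u<v v<y′)))
              (Within.stays (within f) v (≤-trans x′≤u (<⇒≤ u<v) , <-end (<⇒≤ x′<y′) v<y′))

      from-cut : (∃ λ j → l ≤ j × suc j < r × Col.Cut s second false l (suc j) r) →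
        ∃ λ s′ → Improves l k s s′ × bad s′ u v ≡ false
      from-cut (j , l≤j , 1+j<r , good) with <-≤-connex pv (suc j) | <-≤-connex pu (suc j)
      ... | inj₁ v≤j | _ = from-interval ≤-refl (<⇒≤ 1+j<r) (inj₂ 1+j<r)
              (Col.homogeneous-interval s l r r≤n u<v col-bad l (suc j) ≤-refl l≤u v≤j (<⇒≤ 1+j<r) closed)
        where
        closed : Col.Closed s l r l (suc j)
        closed w p l≤w w<r (inj₁ w<l) l≤p p≤j = contradiction l≤w (<⇒≱ w<l)
        closed w p l≤w w<r (inj₂ j<w) l≤p p≤j =
          trans (cong proj₂ (colour-sym s (vertex s w) (vertex s p))) (good p w l≤p p≤j j<w w<r)
      ... | inj₂ _ | inj₂ j<u = from-interval (m≤n⇒m≤1+n l≤j) ≤-refl (inj₁ (s≤s l≤j))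
              (Col.homogeneous-interval s l r r≤n u<v col-bad (suc j) r (m≤n⇒m≤1+n l≤j) j<u v<r ≤-refl closed)
        where
        closed : Col.Closed s l r (suc j) r
        closed w p l≤w w<r (inj₁ w≤j) j<p p<r = good w p l≤w w≤j j<p p<r
        closed w p l≤w w<r (inj₂ r≤w) j<p p<r = contradiction w<r (≤⇒≯ r≤w)
      ... | inj₂ j<v | inj₁ u≤j = case trans (sym col-bad) (good pu pv l≤u u≤j j<v v<r) of λ ()

    repair : ∀ P s → Homog l k s → GoodCut P l k s → Splits P l k s → ∀ u v →
      ∃ λ s′ → Improves l k s s′ × (Block l k (position s′ u) → Block l k (position s′ v) → bad s′ u v ≡ false)
    repair P s hom cut splits u v with block? l k (position s u) | block? l k (position s v)
    ... | inj₂ ¬b | _ = s , record { step = step-refl ; keeps-good = λ _ _ g → g } , λ b _ → contradiction b ¬b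
    ... | _ | inj₂ ¬b = s , record { step = step-refl ; keeps-good = λ _ _ g → g } , λ _ b → contradiction b ¬b
    ... | inj₁ bu | inj₁ bv with bad s u v in buv
    ...   | false = s , record { step = step-refl ; keeps-good = λ _ _ g → g } , λ _ _ → buv
    ...   | true with <-cmp (toℕ (position s u)) (toℕ (position s v))
    ...     | tri< u<v _ _ = let s′ , i , g = repair-ordered P s hom cut splits u v bu bv u<v buv
                             in  s′ , i , λ _ _ → g
    ...     | tri> _ _ v<u = let s′ , i , g = repair-ordered P s hom cut splits v u bv bu v<u (trans (bad-sym s v u) buv)
                             in  s′ , i , λ _ _ → trans (bad-sym s′ u v) g
    ...     | tri≈ _ eq _ = case trans (sym buv) (trans (cong (bad s u)
                              (sym (⟨$⟩ʳ-injective (pos (conf s)) (toℕ-injective eq)))) (bad-irrefl s u)) of λ ()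

    -- Since a repair spoils no good pair, treating the pairs one after another leaves all of them
    -- good.
    repair-list : ∀ P ps s → Homog l k s → GoodCut P l k s → Splits P l k s →
      ∃ λ s′ → Improves l k s s′ × (∀ {u v} → (u , v) ∈ ps →
        Block l k (position s′ u) → Block l k (position s′ v) → bad s′ u v ≡ false)
    repair-list P []             s hom cut splits = s , record { step = step-refl ; keeps-good = λ _ _ g → g } , λ ()
    repair-list P ((u , v) ∷ ps) s hom cut splits =
      let s₁ , i₁ , g₁ = repair P s hom cut splits u v
          s₂ , i₂ , g₂ = repair-list P ps s₁ (homog-step (step i₁) hom)
                           (good-cut-step {P} i₁ cut) (splits-step {P} (step i₁) splits)
      in  s₂ ,
          record { step = step-trans (step i₁) (step i₂) ; keeps-good = λ x y → keeps-good i₂ x y ∘ keeps-good i₁ x y } ,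
          λ where
            (here refl) bu bv → keeps-good i₂ u v
              (g₁ (within-block (within (step i₂)) u bu) (within-block (within (step i₂)) v bv))
            (there m) → g₂ m

    good-cut⇒result : ∀ P s → Homog l k s → GoodCut P l k s → Splits P l k s → Result l k s
    good-cut⇒result P s hom cut splits =
      let s′ , i , good = repair-list P (cartesianProduct (allFin n) (allFin n)) s hom cut splits
      in  s′ , step i , λ u v → good (∈-cartesianProduct⁺ (∈-allFin u) (∈-allFin v))

  before : State → ℕ → Fin n → Bool
  before s m u = toℕ (position s u) <ᵇ m

  cut-colour : ∀ {l k m} F {b} s → Col.Cut s F b l m (l + k) → ∀ u v →
    Block l k (position s u) → Block l k (position s v) → before s m u ≢ before s m v →
    eval F (colour s u v) ≡ b
  cut-colour {l} {k} {m} F s cut u v (l≤u , u<r) (l≤v , v<r) P≢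
    with before s m u in equ | before s m v in eqv
  ... | true  | true  = contradiction refl P≢
  ... | false | false = contradiction refl P≢
  ... | true  | false = trans (cong (eval F) (sym (col-position s u v)))
          (cut _ _ l≤u (<ᵇ-true⇒< _ m equ) (<ᵇ-false⇒≥ _ m eqv) v<r)
  ... | false | true  = trans (cong (eval F) (trans (colour-sym s u v) (sym (col-position s v u))))
          (cut _ _ l≤v (<ᵇ-true⇒< _ m eqv) (<ᵇ-false⇒≥ _ m equ) u<r)

  splits-before : ∀ {l k m} s → l + k ≤ n → l < m → m < l + k → Splits (before s m) l k s
  splits-before {l} {k} {m} s r≤n l<m m<r =
    vertex s l , vertex s m , vertex-block s r≤n ≤-refl (<-trans l<m m<r) , vertex-block s r≤n (<⇒≤ l<m) m<r ,
    λ eq → case trans (sym (<⇒<ᵇ-true (subst (_< m) (sym (toℕ-vertex s l<n)) l<m)))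
                (trans eq (≥⇒<ᵇ-false (subst (m ≤_) (sym (toℕ-vertex s m<n)) ≤-refl))) of λ ()
    where
    m<n : m < n
    m<n = <-≤-trans m<r r≤n
    l<n : l < n
    l<n = <-trans l<m m<n

  module _ {l k : ℕ} (r≤n : l + k ≤ n) (1<k : 1 < k) (rec : ∀ {j} → j < k → Fixable j) where

    private
      r = l + k

    UniformCut : Bool → (Fin n → Bool) → State → Set
    UniformCut b P s = ∀ u v → Block l k (position s u) → Block l k (position s v) → P u ≢ P v → bad s u v ≡ b

    uniform-cut⇒result : ∀ b P s → Homog l k s → UniformCut b P s → Splits P l k s → Result l k s
    uniform-cut⇒result false P s hom cut splits = good-cut⇒result r≤n rec P s hom cut splits
    uniform-cut⇒result true  P s hom cut splits =
      let s′ , f , flips = vertical-step s (<⇒≤ 1<k) r≤n hom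
      in  result-after f (good-cut⇒result r≤n rec P s′ (homog-step f hom)
            (λ u v bu bv P≢ → let bu′ = within-block (within f) u bu ; bv′ = within-block (within f) v bv in
               trans (flips u v bu′ bv′ (P≢ ∘ cong P)) (cong not (cut u v bu′ bv′ P≢)))
            (splits-step {P} f splits))

    -- Constant edges across the cut make `[m,r)` homogeneous, so `rec` sorts it. Then `shuffle-cut`
    -- gives either a cut with constant bad bit, which finishes the block, or a cut with constant
    -- edges at a smaller position, which is why the recursion is on `m`.
    first-cut⇒result : ∀ e m s → Acc _<_ m → Homog l k s → l < m → m < r → Col.Cut s first e l m r → Result l k s
    first-cut⇒result e m s (acc smaller) hom l<m m<r cut = continue (rec shorter m s m+≤n right-homogeneous)
      where
      m+ : m + (r ∸ m) ≡ r
      m+ = m+[n∸m]≡n (<⇒≤ m<r)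

      m+≤n : m + (r ∸ m) ≤ n
      m+≤n = subst (_≤ n) (sym m+) r≤n

      shorter : r ∸ m < k
      shorter = +-cancelˡ-< m _ _ (subst (_< m + k) (sym m+) (+-monoˡ-< k l<m))

      vertex-cut : ∀ u v → l ≤ toℕ (position s u) → toℕ (position s u) < m → Block m (r ∸ m) (position s v) →
                   edge t u v ≡ e
      vertex-cut u v l≤u u<m (m≤v , v<r) = trans (cong proj₁ (sym (col-position s u v)))
        (cut _ _ l≤u u<m m≤v (<-≤-trans v<r (≤-reflexive m+)))

      right-homogeneous : Homog m (r ∸ m) s
      right-homogeneous w u v ¬bw bu@(m≤u , u<r) bv@(m≤v , v<r) with block? l k (position s w)
      ... | inj₂ ¬b = hom w u v ¬b (≤-trans (<⇒≤ l<m) m≤u , <-≤-trans u<r (≤-reflexive m+))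
                                   (≤-trans (<⇒≤ l<m) m≤v , <-≤-trans v<r (≤-reflexive m+))
      ... | inj₁ (l≤w , w<r) = trans (vertex-cut w u l≤w w<m bu) (sym (vertex-cut w v l≤w w<m bv))
        where
        w<m : toℕ (position s w) < m
        w<m = ≰⇒> λ m≤w → ¬bw (m≤w , <-≤-trans w<r (≤-reflexive (sym m+)))

      continue : Result m (r ∸ m) s → Result l k s
      continue (s₁ , f , good) = result-after f′ (case Col.shuffle-cut s₁ r≤n l<m m<r cut₁ good₁ of λ where
          (inj₁ (j , l≤j , 1+j<m , cut′)) →
            first-cut⇒result e (suc j) s₁ (smaller 1+j<m) hom₁ (s≤s l≤j) (<-trans 1+j<m m<r) cut′
          (inj₂ (m′ , b , l<m′ , m′<r , cut′)) →
            uniform-cut⇒result b (before s₁ m′) s₁ hom₁ (cut-colour second s₁ cut′)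
              (splits-before s₁ r≤n l<m′ m′<r))
        where
        f′ : Step l k s s₁
        f′ = step-mono (<⇒≤ l<m) (≤-reflexive m+) f

        hom₁ : Homog l k s₁
        hom₁ = homog-step f′ hom

        right-block : ∀ {q} → m ≤ q → q < r → Block m (r ∸ m) (position s₁ (vertex s₁ q))
        right-block m≤q q<r = vertex-block s₁ m+≤n m≤q (<-≤-trans q<r (≤-reflexive (sym m+)))

        good₁ : ∀ q q′ → m ≤ q → q < q′ → q′ < r → proj₂ (col s₁ q q′) ≡ false
        good₁ q q′ m≤q q<q′ q′<r =
          good _ _ (right-block m≤q (<-trans q<q′ q′<r)) (right-block (≤-trans m≤q (<⇒≤ q<q′)) q′<r)

        -- Sorting keeps the vertices below `m` in place and those of `[m,r)` within it, so the cut
        -- by edges survives.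
        cut₁ : Col.Cut s₁ first e l m r
        cut₁ p q l≤p p<m m≤q q<r = vertex-cut u (vertex s₁ q)
            (subst (l ≤_) (sym p≡) l≤p) (subst (_< m) (sym p≡) p<m)
            (within-block (within f) _ (right-block m≤q q<r))
          where
          u : Fin n
          u = vertex s₁ p
          pos₁ : toℕ (position s₁ u) ≡ p
          pos₁ = toℕ-vertex s₁ (<-≤-trans (<-trans p<m m<r) r≤n)
          outer : ¬ Block m (r ∸ m) (position s u)
          outer b = <⇒≱ p<m (subst (m ≤_) pos₁ (proj₁ (Within.stays (within f) u b)))
          p≡ : toℕ (position s u) ≡ p
          p≡ = trans (cong toℕ (sym (Within.fixed (within f) u outer))) pos₁

    cut⇒result : ∀ F b m s → Homog l k s → l < m → m < r → Col.Cut s F b l m r → Result l k s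
    cut⇒result first  b m s hom l<m m<r cut = first-cut⇒result b m s (<-wellFounded m) hom l<m m<r cut
    cut⇒result second b m s hom l<m m<r cut =
      uniform-cut⇒result b (before s m) s hom (cut-colour second s cut) (splits-before s r≤n l<m m<r)
    cut⇒result total  b m s hom l<m m<r cut =
      let s′ , f , flips = horizontal-step s 1<k r≤n hom
      in  result-after f (uniform-cut⇒result b (before s m) s′ (homog-step f hom)
            (λ u v bu bv P≢ → let bu′ = within-block (within f) u bu ; bv′ = within-block (within f) v bv in
               trans (flips u v bu′ bv′) (cut-colour total s cut u v bu′ bv′ P≢))
            (splits-step {before s m} f (splits-before s r≤n l<m m<r)))

  fixable : ∀ k → Acc _<_ k → Fixable k
  fixable zero _ l s r≤n hom = s , step-refl , λ u v (l≤u , u<l) → contradiction l≤u (<⇒≱ (<-≤-trans u<l (≤-reflexive (+-identityʳ l))))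
  fixable (suc zero) _ l s r≤n hom = s , step-refl , λ u v bu bv →
      trans (cong (bad s u) (⟨$⟩ʳ-injective (pos (conf s)) (toℕ-injective (trans (only bv) (sym (only bu)))))) (bad-irrefl s u)
    where
    only : ∀ {i : Fin n} → Block l 1 i → toℕ i ≡ l
    only (l≤i , i<l+1) = ≤-antisym (≤-pred (<-≤-trans i<l+1 (≤-reflexive (+-comm l 1)))) l≤i
  fixable (suc (suc k)) (acc rec) l s r≤n hom =
    -- `v` is the last position of the block: `suc v` is its end `l + suc (suc k)`.
    let v = l + suc k
        r≡ = +-suc l (suc k)
        F , b , m , l<m , m≤v , cut = Col.gallai-cut s l v (m<m+n l z<s) (subst (_≤ n) r≡ r≤n)
    in  cut⇒result r≤n (s≤s z<s) (λ j<k → fixable _ (rec j<k)) F b m s hom l<m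
          (subst (m <_) (sym r≡) (s≤s m≤v)) (subst (Col.Cut s F b l m) (sym r≡) cut)

  sortable : ∀ s → ∃ λ s′ → SpindleEquivalent (spindle (conf s)) (spindle (conf s′)) × (∀ u v → bad s′ u v ≡ false)
  sortable s =
    -- The block of all vertices is homogeneous because no vertex lies outside it.
    let s′ , f , good = fixable n (<-wellFounded n) 0 s ≤-refl (λ w u v ¬b → contradiction (z≤n , toℕ<n _) ¬b)
    in  s′ , equivalent f , λ u v → good u v (z≤n , toℕ<n _) (z≤n , toℕ<n _)

-- Switching by rotations and the choice of a first vertex.

overflow-% : ∀ {n} .{{_ : NonZero n}} {c l} → c < n → l ≤ n → n ≤ c + l →
             n + (c + l) % n ≡ c + l × (c + l) % n < l
overflow-% {n} {c} {l} c<n l≤n n≤c+l =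
  trans (cong (n +_) (sym reduced)) (m+[n∸m]≡n n≤c+l) , subst (_< l) reduced small
  where
  small : c + l ∸ n < l
  small = subst (c + l ∸ n <_) (m+n∸m≡n n l) (∸-monoˡ-< (+-monoˡ-< l c<n) n≤c+l)
  reduced : c + l ∸ n ≡ (c + l) % n
  reduced = trans (sym (m<n⇒m%n≡m (<-≤-trans small l≤n))) (m≤n⇒[n∸m]%m≡n%m n≤c+l)

-- A rank that wraps around ends below `l`, one that does not ends at `l` or above. So a comparison
-- is complemented exactly when one of the two ranks wraps.
wrap-precedes : ∀ {n} .{{_ : NonZero n}} {a b} l → a < n → b < n → l ≤ n →
  ((a + l) % n <ᵇ (b + l) % n) ≡ (a <ᵇ b) xor (not (a + l <ᵇ n) xor not (b + l <ᵇ n))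
wrap-precedes {n} {a} {b} l a<n b<n l≤n with <-≤-connex (a + l) n | <-≤-connex (b + l) n
... | inj₁ a+ | inj₁ b+
      rewrite <⇒<ᵇ-true a+ | <⇒<ᵇ-true b+ | m<n⇒m%n≡m a+ | m<n⇒m%n≡m b+ | +-comm a l | +-comm b l =
      trans (<ᵇ-+ l) (sym (Boolₚ.xor-identityʳ _))
... | inj₁ a+ | inj₂ +b
      rewrite <⇒<ᵇ-true a+ | ≥⇒<ᵇ-false +b | m<n⇒m%n≡m a+ | <⇒<ᵇ-true (+-cancelʳ-< l a b (<-≤-trans a+ +b)) =
      ≥⇒<ᵇ-false (≤-trans (<⇒≤ (proj₂ (overflow-% b<n l≤n +b))) (m≤n+m l a))
... | inj₂ +a | inj₁ b+
      rewrite ≥⇒<ᵇ-false +a | <⇒<ᵇ-true b+ | m<n⇒m%n≡m b+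
            | ≥⇒<ᵇ-false (<⇒≤ (+-cancelʳ-< l b a (<-≤-trans b+ +a))) =
      <⇒<ᵇ-true (<-≤-trans (proj₂ (overflow-% a<n l≤n +a)) (m≤n+m l b))
... | inj₂ +a | inj₂ +b
      rewrite ≥⇒<ᵇ-false +a | ≥⇒<ᵇ-false +b = begin
        ((a + l) % n <ᵇ (b + l) % n)          ≡⟨ <ᵇ-+ n ⟨
        (n + (a + l) % n <ᵇ n + (b + l) % n)  ≡⟨ cong₂ _<ᵇ_ (proj₁ (overflow-% a<n l≤n +a)) (proj₁ (overflow-% b<n l≤n +b)) ⟩
        (a + l <ᵇ b + l)                      ≡⟨ cong₂ _<ᵇ_ (+-comm a l) (+-comm b l) ⟩
        (l + a <ᵇ l + b)                      ≡⟨ <ᵇ-+ l ⟩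
        (a <ᵇ b)                              ≡⟨ Boolₚ.xor-identityʳ _ ⟨
        (a <ᵇ b) xor false                    ∎
  where open ≡-Reasoning

-- Seidel switching of a graph at the vertices where `switch` is true. The diagonal is left out
-- because linking matrices have zeros there instead of signs.
record Switched {A : Set} (e e′ : A → A → Bool) : Set where
  constructor switched
  field
    switch : A → Bool
    switches : ∀ u v → u ≢ v → e′ u v ≡ e u v xor (switch u xor switch v)

open Switched

xor-swap : ∀ {x y} z → x ≡ y xor z → y ≡ x xor z
xor-swap {x} {y} z eq = sym (trans (cong (_xor z) eq) (trans (Boolₚ.xor-assoc y z z)
  (trans (cong (y xor_) (Boolₚ.xor-same z)) (Boolₚ.xor-identityʳ y))))

switched-sym : ∀ {A} {e e′ : A → A → Bool} → Switched e e′ → Switched e′ e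
switched-sym s = switched (switch s) λ u v u≢v → xor-swap _ (switches s u v u≢v)

switched-trans : ∀ {A} {e e′ e″ : A → A → Bool} → Switched e e′ → Switched e′ e″ → Switched e e″
switched-trans {e = e} s s′ = switched (λ u → switch s u xor switch s′ u) λ u v u≢v →
  trans (switches s′ u v u≢v) (trans (cong (_xor _) (switches s u v u≢v))
    (regroup (e u v) (switch s u) (switch s v) (switch s′ u) (switch s′ v)))
  where
  regroup : ∀ x a b a′ b′ → (x xor (a xor b)) xor (a′ xor b′) ≡ x xor ((a xor a′) xor (b xor b′))
  regroup = solve 5 (λ x a b a′ b′ → (x :+ (a :+ b)) :+ (a′ :+ b′) := x :+ ((a :+ a′) :+ (b :+ b′))) refl
    where open xor-∧-Solver

module _ {n : ℕ} .{{_ : NonZero n}} where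

  precedes-cong : ∀ {p q : Permutation′ n} → p ≈ q → ∀ u v → precedes p u v ≡ precedes q u v
  precedes-cong p≈q u v = cong₂ (λ x y → toℕ x <ᵇ toℕ y) (p≈q u) (p≈q v)

  precedes-rotate : ∀ {l} (p : Permutation′ n) → l ≤ n → Switched (precedes p) (precedes (p ∘ₚ rotate l))
  precedes-rotate {l} p l≤n = switched (λ u → not (toℕ (p ⟨$⟩ʳ u) + l <ᵇ n)) λ u v _ →
    trans (cong₂ _<ᵇ_ (toℕ-mod {n} (toℕ (p ⟨$⟩ʳ u) + l)) (toℕ-mod {n} (toℕ (p ⟨$⟩ʳ v) + l))) (wrap-precedes l (toℕ<n _) (toℕ<n _) l≤n)

  edge-rotated : ∀ {l l′} (c : Configuration n) → l ≤ n → l′ ≤ n → Switched (edge c) (edge (rotated l l′ c))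
  edge-rotated c l≤n l′≤n =
    let p = precedes-rotate (pos c) l≤n
        q = precedes-rotate (val c) l′≤n
    in  switched (λ u → switch p u xor switch q u) λ u v u≢v →
        trans (cong₂ _xor_ (switches p u v u≢v) (switches q u v u≢v))
          (regroup (precedes (pos c) u v) (precedes (val c) u v) (switch p u) (switch p v) (switch q u) (switch q v))
    where
    regroup : ∀ x y a b a′ b′ → (x xor (a xor b)) xor (y xor (a′ xor b′)) ≡ (x xor y) xor ((a xor a′) xor (b xor b′))
    regroup = solve 6 (λ x y a b a′ b′ → (x :+ (a :+ b)) :+ (y :+ (a′ :+ b′)) := (x :+ y) :+ ((a :+ a′) :+ (b :+ b′))) refl
      where open xor-∧-Solver

  -- Induction on the rank of `u` in `p`: the vertex just before `u` in `p` also precedes `u` in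
  -- `q`, where its rank is large enough by induction.
  precedes-≤ : ∀ (p q : Permutation′ n) → (∀ u v → precedes p u v ≡ precedes q u v) →
               ∀ u → toℕ (p ⟨$⟩ʳ u) ≤ toℕ (q ⟨$⟩ʳ u)
  precedes-≤ p q same u = go _ u refl
    where
    go : ∀ m u → toℕ (p ⟨$⟩ʳ u) ≡ m → m ≤ toℕ (q ⟨$⟩ʳ u)
    go zero    u eq = z≤n
    go (suc m) u eq = ≤-<-trans (go m v pv) (<ᵇ-true⇒< _ _ (trans (sym (same v u))
        (<⇒<ᵇ-true (subst₂ _<_ (sym pv) (sym eq) ≤-refl))))
      where
      v : Fin n
      v = p ⟨$⟩ˡ (m mod n)
      pv : toℕ (p ⟨$⟩ʳ v) ≡ m
      pv = trans (cong toℕ (inverseʳ p)) (toℕ-mod-< (<-trans (subst (m <_) (sym eq) ≤-refl) (toℕ<n (p ⟨$⟩ʳ u))))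

  precedes-injective : ∀ (p q : Permutation′ n) → (∀ u v → precedes p u v ≡ precedes q u v) → p ≈ q
  precedes-injective p q same u = toℕ-injective
    (≤-antisym (precedes-≤ p q same u) (precedes-≤ q p (λ u v → sym (same u v)) u))

  spindle-cong : ∀ {c c′ : Configuration n} → pos c ≈ pos c′ → val c ≈ val c′ → spindle c ≈ spindle c′
  spindle-cong {c} {c′} p v i = trans (v _) (cong (val c′ ⟨$⟩ʳ_)
    (⟨$⟩ʳ-injective (pos c′) (trans (sym (p _)) (trans (inverseʳ (pos c)) (sym (inverseʳ (pos c′)))))))

  edge-irrefl : ∀ (c : Configuration n) u → edge c u u ≡ false
  edge-irrefl c u rewrite <ᵇ-irrefl (toℕ (pos c ⟨$⟩ʳ u)) = <ᵇ-irrefl (toℕ (val c ⟨$⟩ʳ u))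

  -- When no pair is bad the position orders agree. Cancelling them from the equal edges leaves
  -- equal value orders, and the comparisons of an order determine its ranks.
  edge-≡⇒equivalent : ∀ (c d : Configuration n) → (∀ u v → edge c u v ≡ edge d u v) →
                      SpindleEquivalent (spindle c) (spindle d)
  edge-≡⇒equivalent c d same =
    let s′ , equiv , good = Sorted.sortable d record { conf = c ; edge-≡ = same }
        same-pos = λ u v → xor-≡ (precedes (pos (State.conf s′)) u v) (good u v)
        same-val = λ u v → xor-cancelˡ (precedes (pos (State.conf s′)) u v)
          (trans (State.edge-≡ s′ u v) (cong (_xor precedes (val d) u v) (sym (same-pos u v))))
    in  Eq.transitive _ equiv (≈⇒equivalent (spindle-cong {State.conf s′} {d}
          (precedes-injective (pos (State.conf s′)) (pos d) same-pos) (precedes-injective (val (State.conf s′)) (val d) same-val)))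
    where
    open Sorting d
    xor-≡ : ∀ x {y} → x xor y ≡ false → x ≡ y
    xor-≡ true  {true} _  = refl
    xor-≡ false        eq = sym eq

  module _ (o : Fin n) where

    based : Configuration n → Configuration n
    based c = unrotated (toℕ (pos c ⟨$⟩ʳ o)) (toℕ (val c ⟨$⟩ʳ o)) c

    based-equivalent : ∀ c → SpindleEquivalent (spindle c) (spindle (based c))
    based-equivalent c = unrotated-equivalent c (toℕ<n _) (toℕ<n _)

    edge-based : ∀ c → Switched (edge (based c)) (edge c)
    edge-based c =
      let s = edge-rotated (based c) (<⇒≤ (toℕ<n (pos c ⟨$⟩ʳ o))) (<⇒≤ (toℕ<n (val c ⟨$⟩ʳ o)))
      in  switched (switch s) λ u v u≢v → trans
            (sym (cong₂ _xor_ (precedes-cong {(pos c ∘ₚ flip (rotate (toℕ (pos c ⟨$⟩ʳ o)))) ∘ₚ rotate (toℕ (pos c ⟨$⟩ʳ o))} {pos c}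
                                 (λ _ → inverseʳ (rotate (toℕ (pos c ⟨$⟩ʳ o)))) u v)
                              (precedes-cong {(val c ∘ₚ flip (rotate (toℕ (val c ⟨$⟩ʳ o)))) ∘ₚ rotate (toℕ (val c ⟨$⟩ʳ o))} {val c}
                                 (λ _ → inverseʳ (rotate (toℕ (val c ⟨$⟩ʳ o)))) u v)))
            (switches s u v u≢v)

    origin-first : ∀ (p : Permutation′ n) {v} → o ≢ v →
      precedes (p ∘ₚ flip (rotate (toℕ (p ⟨$⟩ʳ o)))) o v ≡ true
    origin-first p {v} o≢v = <⇒<ᵇ-true (subst (_< toℕ (q ⟨$⟩ʳ v)) (sym q-o)
        (n≢0⇒n>0 λ q-v → o≢v (⟨$⟩ʳ-injective q (toℕ-injective (trans q-o (sym q-v))))))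
      where
      l = toℕ (p ⟨$⟩ʳ o)
      q = p ∘ₚ flip (rotate l)
      origin : Fin n
      origin = 0 mod n
      toℕ-origin : toℕ origin ≡ 0
      toℕ-origin = toℕ-mod-< 0<n
      q-o : toℕ (q ⟨$⟩ʳ o) ≡ 0
      q-o = trans (cong toℕ (trans (cong (rotate l ⟨$⟩ˡ_) (toℕ-injective (sym (trans
                (cong (λ x → toℕ ((x + l) mod n)) toℕ-origin) (toℕ-mod-< (toℕ<n (p ⟨$⟩ʳ o)))))))
              (inverseˡ (rotate l)))) toℕ-origin

    edge-origin : ∀ c {v} → o ≢ v → edge (based c) o v ≡ false
    edge-origin c o≢v = cong₂ _xor_ (origin-first (pos c) o≢v) (origin-first (val c) o≢v)

    -- The vertex o comes first in both orders of both configurations, so it is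
    -- isolated in both graphs and the switch between them is constant.

    based-edge-≡ : ∀ c d → Switched (edge c) (edge d) → ∀ u v → edge (based c) u v ≡ edge (based d) u v
    based-edge-≡ c d s u v with u ≟ v
    ... | yes refl = trans (edge-irrefl (based c) u) (sym (edge-irrefl (based d) u))
    ... | no  u≢v = xor-constant (constant u) (constant v) (switches s₀ u v u≢v)
      where
      s₀ : Switched (edge (based c)) (edge (based d))
      s₀ = switched-trans (edge-based c) (switched-trans s (switched-sym (edge-based d)))
      xor-≡ : ∀ x {y} → false ≡ x xor y → y ≡ x
      xor-≡ true  {true} _  = refl
      xor-≡ false        eq = sym eq
      constant : ∀ v → switch s₀ v ≡ switch s₀ o
      constant v with o ≟ v
      ... | yes refl = refl
      ... | no  o≢v = xor-≡ (switch s₀ o) (trans (sym (edge-origin d o≢v))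
              (trans (switches s₀ o v o≢v) (cong (_xor (switch s₀ o xor switch s₀ v)) (edge-origin c o≢v))))
      xor-constant : ∀ {x y a b k} → a ≡ k → b ≡ k → y ≡ x xor (a xor b) → x ≡ y
      xor-constant {x} {k = k} refl refl eq =
        sym (trans eq (trans (cong (x xor_) (Boolₚ.xor-same k)) (Boolₚ.xor-identityʳ x)))

  switched⇒equivalent : ∀ (c d : Configuration n) → Switched (edge c) (edge d) →
                        SpindleEquivalent (spindle c) (spindle d)
  switched⇒equivalent c d s = Eq.transitive _ (based-equivalent o c)
    (Eq.transitive _ (edge-≡⇒equivalent (based o c) (based o d) (based-edge-≡ o c d s))
      (Eq.symmetric _ (based-equivalent o d)))
    where
    -- The base point may be any vertex; one exists because `n` is nonzero.
    o : Fin n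
    o = 0 mod n

  -- Inversion graphs up to relabelling and switching.

  inversion : Permutation′ n → Fin n → Fin n → Bool
  inversion σ = edge ⟨ id , σ ⟩

  -- The Boolean form of switching equivalence of linking matrices: `relabelling` stands for the
  -- permutation matrix and `switching` for the diagonal signs.
  record SimilarInversions (σ μ : Permutation′ n) : Set where
    constructor similar
    field
      relabelling : Permutation′ n
      switching   : Switched (λ i j → inversion σ (relabelling ⟨$⟩ʳ i) (relabelling ⟨$⟩ʳ j)) (inversion μ)

  -- The relabelling is absorbed into a configuration: `⟨ π , π ∘ₚ σ ⟩` has spindle `σ`, and its
  -- edges are the relabelled inversions of `σ`.
  similar⇒equivalent : ∀ {σ μ} → SimilarInversions σ μ → SpindleEquivalent σ μ
  similar⇒equivalent {σ} {μ} (similar π s) = Eq.transitive _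
    (≈⇒equivalent {μ = spindle ⟨ π , π ∘ₚ σ ⟩} λ i → cong (σ ⟨$⟩ʳ_) (sym (inverseʳ π)))
    (Eq.transitive _ (switched⇒equivalent ⟨ π , π ∘ₚ σ ⟩ ⟨ id , μ ⟩ s)
      (≈⇒equivalent {σ = spindle ⟨ id , μ ⟩} {μ = μ} λ i → refl))

  similar-refl : ∀ {σ} → SimilarInversions σ σ
  similar-refl {σ} = similar id (switched (λ _ → false) λ i j _ → sym (Boolₚ.xor-identityʳ (inversion σ i j)))

  similar-sym : ∀ {σ μ} → SimilarInversions σ μ → SimilarInversions μ σ
  similar-sym {σ} {μ} (similar π s) = similar (flip π) (switched (λ i → switch s (π ⟨$⟩ˡ i)) λ i j i≢j → xor-swap _
    (trans (switches s (π ⟨$⟩ˡ i) (π ⟨$⟩ˡ j) (i≢j ∘ ⟨$⟩ʳ-injective (flip π)))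
      (cong (_xor _) (cong₂ (inversion σ) (inverseʳ π) (inverseʳ π)))))

  similar-trans : ∀ {σ μ ν} → SimilarInversions σ μ → SimilarInversions μ ν → SimilarInversions σ ν
  similar-trans (similar π s) (similar π′ s′) = similar (π′ ∘ₚ π)
    (switched-trans (switched (λ i → switch s (π′ ⟨$⟩ʳ i)) λ i j i≢j →
      switches s (π′ ⟨$⟩ʳ i) (π′ ⟨$⟩ʳ j) (i≢j ∘ ⟨$⟩ʳ-injective π′)) s′)

  similar-isEquivalence : IsEquivalence SimilarInversions
  similar-isEquivalence = record { refl = similar-refl ; sym = similar-sym ; trans = similar-trans }

  relabelled⇒similar : ∀ {σ μ} (π : Permutation′ n) →
    (∀ i j → inversion μ i j ≡ inversion σ (π ⟨$⟩ʳ i) (π ⟨$⟩ʳ j)) → SimilarInversions σ μ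
  relabelled⇒similar π same = similar π (switched (λ _ → false) λ i j _ →
    trans (same i j) (sym (Boolₚ.xor-identityʳ _)))

  precedes-xor-cross : ∀ (p q : Permutation′ n) u v →
    precedes p u v xor precedes q v u ≡ precedes p v u xor precedes q u v
  precedes-xor-cross p q u v with u ≟ v
  ... | yes refl = refl
  ... | no  u≢v rewrite precedes-flip p u≢v | precedes-flip q u≢v =
        trans (sym (Boolₚ.not-distribʳ-xor (precedes p u v) _)) (Boolₚ.not-distribˡ-xor (precedes p u v) _)

  -- Relabelling by `rotate t` rotates the positions, and `rotate s` rotates the values. Each
  -- rotation switches at the vertices that wrap around, and the two switches add up.
  circular⇒similar : ∀ {σ μ : Permutation′ n} s t → s < n → t < n →
    (∀ i → μ ⟨$⟩ʳ i ≡ rotate s ⟨$⟩ʳ (σ ⟨$⟩ʳ (rotate t ⟨$⟩ʳ i))) → SimilarInversions σ μ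
  circular⇒similar {σ} {μ} s t s<n t<n h =
    let a = precedes-rotate id (<⇒≤ t<n)
        b = precedes-rotate (rotate t ∘ₚ σ) (<⇒≤ s<n)
    in  similar (rotate t) (switched (λ i → switch a i xor switch b i) λ i j i≢j → trans
          (cong (precedes id i j xor_) (trans
            (precedes-cong {μ} {(rotate t ∘ₚ σ) ∘ₚ rotate s} h i j) (switches b i j i≢j)))
          (trans (regroup (precedes id i j) (precedes (rotate t ∘ₚ σ) i j) (switch a i) (switch a j) (switch b i) (switch b j))
            (cong (λ x → (x xor precedes (rotate t ∘ₚ σ) i j) xor ((switch a i xor switch b i) xor (switch a j xor switch b j)))
              (sym (switches a i j i≢j)))))
    where
    regroup : ∀ x y a b a′ b′ →
      x xor (y xor (a′ xor b′)) ≡ ((x xor (a xor b)) xor y) xor ((a xor a′) xor (b xor b′))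
    regroup = solve 6 (λ x y a b a′ b′ →
      x :+ (y :+ (a′ :+ b′)) := ((x :+ (a :+ b)) :+ y) :+ ((a :+ a′) :+ (b :+ b′))) refl
      where open xor-∧-Solver

  -- The reflection itself serves as relabelling. Inside the block both orders are reversed, which
  -- leaves disagreements unchanged; all other pairs keep both comparisons.
  vertical⇒similar : ∀ {σ μ : Permutation′ n} k (k≤n : k ≤ n) → (∀ i → toℕ i < k ⇔ toℕ (σ ⟨$⟩ʳ i) < k) →
    (∀ i → μ ⟨$⟩ʳ i ≡ reflect k k≤n ⟨$⟩ʳ (σ ⟨$⟩ʳ (reflect k k≤n ⟨$⟩ʳ i))) → SimilarInversions σ μ
  vertical⇒similar {σ} {μ} k k≤n stab h = relabelled⇒similar ρ same
    where
    ρ = reflect k k≤n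

    reflect-within : ∀ (p : Permutation′ n) → Within 0 k p (p ∘ₚ ρ)
    reflect-within p = record
      { fixed = λ u ¬b → reflect-≥ k k≤n _ (≮⇒≥ λ p<k → ¬b (z≤n , p<k))
      ; stays = λ u (_ , p<k) → z≤n , subst (_< k) (sym (toℕ-reflect-< k k≤n _ p<k)) (k∸1+i<k p<k)
      }

    reverses : ∀ (p : Permutation′ n) i j → Block 0 k (p ⟨$⟩ʳ i) → Block 0 k (p ⟨$⟩ʳ j) →
               precedes (p ∘ₚ ρ) i j ≡ precedes p j i
    reverses p i j (_ , i<k) (_ , j<k) = trans
      (cong₂ _<ᵇ_ (toℕ-reflect-< k k≤n _ i<k) (toℕ-reflect-< k k≤n _ j<k)) (reflect-reverses i<k j<k)

    σ-block : ∀ i → Block 0 k i ⇔ Block 0 k (σ ⟨$⟩ʳ (ρ ⟨$⟩ʳ i))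
    σ-block i = mk⇔
      (λ b → z≤n , Equivalence.to (stab _) (proj₂ (Within.stays (reflect-within id) i b)))
      (λ (_ , <k) → within-block (reflect-within id) i (z≤n , Equivalence.from (stab _) <k))

    same : ∀ i j → inversion μ i j ≡ inversion σ (ρ ⟨$⟩ʳ i) (ρ ⟨$⟩ʳ j)
    same i j = trans (cong (precedes id i j xor_) (precedes-cong {μ} {(ρ ∘ₚ σ) ∘ₚ ρ} h i j))
      (case (block? 0 k i , block? 0 k j) of λ where
        (inj₁ bi , inj₁ bj) → trans
          (cong (precedes id i j xor_) (reverses (ρ ∘ₚ σ) i j (Equivalence.to (σ-block i) bi) (Equivalence.to (σ-block j) bj)))
          (trans (precedes-xor-cross id (ρ ∘ₚ σ) i j)
            (cong (_xor precedes (ρ ∘ₚ σ) i j) (sym (reverses id i j bi bj))))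
        (inj₂ ¬b , _) → outer i j (¬b ∘ proj₁) (¬b ∘ Equivalence.from (σ-block i) ∘ proj₁)
        (_ , inj₂ ¬b) → outer i j (¬b ∘ proj₂) (¬b ∘ Equivalence.from (σ-block j) ∘ proj₂))
      where
      outer : ∀ i j → ¬ (Block 0 k i × Block 0 k j) →
        ¬ (Block 0 k (σ ⟨$⟩ʳ (ρ ⟨$⟩ʳ i)) × Block 0 k (σ ⟨$⟩ʳ (ρ ⟨$⟩ʳ j))) →
        precedes id i j xor precedes ((ρ ∘ₚ σ) ∘ₚ ρ) i j ≡ precedes ρ i j xor precedes (ρ ∘ₚ σ) i j
      outer i j ¬ij ¬σij = cong₂ _xor_
        (sym (precedes-within (reflect-within id) i j ¬ij))
        (precedes-within (reflect-within (ρ ∘ₚ σ)) i j ¬σij)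

  -- The relabelling `π` is the inverse of `σ` on the block. There `π` agrees with `μ` and `σ`
  -- undoes `π`, so the two comparisons in an inversion merely trade places.
  horizontal⇒similar : ∀ {σ μ : Permutation′ n} k → (∀ i → toℕ i < k ⇔ toℕ (σ ⟨$⟩ʳ i) < k) →
    (∀ i → toℕ i < k → μ ⟨$⟩ʳ i ≡ σ ⟨$⟩ˡ i) → (∀ i → k ≤ toℕ i → μ ⟨$⟩ʳ i ≡ σ ⟨$⟩ʳ i) → SimilarInversions σ μ
  horizontal⇒similar {σ} {μ} k stab h h′ = relabelled⇒similar π same
    where
    stab⁻¹ : ∀ i → toℕ i < k ⇔ toℕ (σ ⟨$⟩ˡ i) < k
    stab⁻¹ i = mk⇔
      (λ i<k → Equivalence.from (stab _) (subst (λ j → toℕ j < k) (sym (inverseʳ σ)) i<k))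
      (λ σi<k → subst (λ j → toℕ j < k) (inverseʳ σ) (Equivalence.to (stab _) σi<k))

    π : Permutation′ n
    π = exchange k id (flip σ) stab⁻¹

    π-< : ∀ i → toℕ i < k → π ⟨$⟩ʳ i ≡ σ ⟨$⟩ˡ i
    π-< = exchange-< k id (flip σ) stab⁻¹

    π-≥ : ∀ i → k ≤ toℕ i → π ⟨$⟩ʳ i ≡ i
    π-≥ = exchange-≥ k id (flip σ) stab⁻¹

    σπ-< : ∀ i → toℕ i < k → σ ⟨$⟩ʳ (π ⟨$⟩ʳ i) ≡ i
    σπ-< i i<k = trans (cong (σ ⟨$⟩ʳ_) (π-< i i<k)) (inverseʳ σ)

    σπ-block : ∀ i → Block 0 k (σ ⟨$⟩ʳ (π ⟨$⟩ʳ i)) → toℕ i < k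
    σπ-block i (_ , <k) with <-≤-connex (toℕ i) k
    ... | inj₁ i<k = i<k
    ... | inj₂ k≤i = Equivalence.from (stab i) (subst (λ j → toℕ (σ ⟨$⟩ʳ j) < k) (π-≥ i k≤i) <k)

    π-within : Within 0 k id π
    π-within = record
      { fixed = λ i ¬b → π-≥ i (≮⇒≥ λ i<k → ¬b (z≤n , i<k))
      ; stays = λ i (_ , i<k) → z≤n , subst (λ j → toℕ j < k) (sym (π-< i i<k)) (Equivalence.to (stab⁻¹ i) i<k)
      }

    μ-within : Within 0 k (π ∘ₚ σ) μ
    μ-within = record
      { fixed = λ i ¬b → let k≤i = ≮⇒≥ λ i<k → ¬b (z≤n , subst (λ j → toℕ j < k) (sym (σπ-< i i<k)) i<k)
                         in  trans (h′ i k≤i) (cong (σ ⟨$⟩ʳ_) (sym (π-≥ i k≤i)))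
      ; stays = λ i b → let i<k = σπ-block i b
                        in  z≤n , subst (λ j → toℕ j < k) (sym (h i i<k)) (Equivalence.to (stab⁻¹ i) i<k)
      }

    same : ∀ i j → inversion μ i j ≡ inversion σ (π ⟨$⟩ʳ i) (π ⟨$⟩ʳ j)
    same i j = case (block? 0 k i , block? 0 k j) of λ where
        (inj₁ (_ , i<k) , inj₁ (_ , j<k)) → trans (Boolₚ.xor-comm (precedes id i j) _) (cong₂ _xor_
          (cong₂ (λ x y → toℕ x <ᵇ toℕ y) (trans (h i i<k) (sym (π-< i i<k))) (trans (h j j<k) (sym (π-< j j<k))))
          (cong₂ (λ x y → toℕ x <ᵇ toℕ y) (sym (σπ-< i i<k)) (sym (σπ-< j j<k))))
        (inj₂ ¬b , _) → outer (¬b ∘ proj₁) (λ (b , _) → ¬b (z≤n , σπ-block i b))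
        (_ , inj₂ ¬b) → outer (¬b ∘ proj₂) (λ (_ , b) → ¬b (z≤n , σπ-block j b))
      where
      outer : ¬ (Block 0 k i × Block 0 k j) →
        ¬ (Block 0 k (σ ⟨$⟩ʳ (π ⟨$⟩ʳ i)) × Block 0 k (σ ⟨$⟩ʳ (π ⟨$⟩ʳ j))) →
        inversion μ i j ≡ inversion σ (π ⟨$⟩ʳ i) (π ⟨$⟩ʳ j)
      outer ¬ij ¬σij = cong₂ _xor_ (sym (precedes-within π-within i j ¬ij)) (precedes-within μ-within i j ¬σij)

  move⇒similar : ∀ {σ μ : Permutation′ n} → SpindleMove σ μ → SimilarInversions σ μ
  move⇒similar {σ} (circular s t s<n t<n h) = circular⇒similar s t s<n t<n λ i → trans (h i)
    (trans (rep-+-label s _) (cong (λ x → rotate s ⟨$⟩ʳ (σ ⟨$⟩ʳ x)) (rep-label-+ i t)))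
  move⇒similar {σ} {μ} (vertical k 1≤k k≤n stab h h′) = vertical⇒similar k k≤n stab⇔ reflected
    where
    stab⇔ = stabilises⇒⇔ {σ = σ} stab
    reflected : ∀ i → μ ⟨$⟩ʳ i ≡ reflect k k≤n ⟨$⟩ʳ (σ ⟨$⟩ʳ (reflect k k≤n ⟨$⟩ʳ i))
    reflected i with <-≤-connex (toℕ i) k
    ... | inj₁ i<k = trans (h i i<k) (trans
            (cong (λ x → rep n (suc k ∸ label (σ ⟨$⟩ʳ x))) (rep-reflect k k≤n i i<k))
            (rep-reflect k k≤n _ (Equivalence.to (stab⇔ _)
              (subst (_< k) (sym (toℕ-reflect-< k k≤n i i<k)) (k∸1+i<k i<k)))))
    ... | inj₂ k≤i = trans (h′ i (s≤s k≤i)) (sym (trans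
            (cong (λ x → reflect k k≤n ⟨$⟩ʳ (σ ⟨$⟩ʳ x)) (reflect-≥ k k≤n i k≤i))
            (reflect-≥ k k≤n _ (≮⇒≥ λ σi<k → <⇒≱ (Equivalence.from (stab⇔ i) σi<k) k≤i))))
  move⇒similar {σ} (horizontal k _ _ stab h h′) =
    horizontal⇒similar k (stabilises⇒⇔ {σ = σ} stab) h (λ i k≤i → h′ i (s≤s k≤i))

  equivalent⇒similar : ∀ {σ μ : Permutation′ n} → SpindleEquivalent σ μ → SimilarInversions σ μ
  equivalent⇒similar = Eq.fold similar-isEquivalence move⇒similar

-- Linking matrices

-- The isomorphism from bits under `xor` to signs under multiplication, with -1 for an edge.
signOf : Bool → ℤ
signOf b = if b then -1ℤ else 1ℤ

signOf-xor : ∀ a b → signOf (a xor b) ≡ signOf a ℤ.* signOf b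
signOf-xor true  true  = refl
signOf-xor true  false = refl
signOf-xor false true  = refl
signOf-xor false false = refl

signOf-injective : ∀ {a b} → signOf a ≡ signOf b → a ≡ b
signOf-injective {true}  {true}  _ = refl
signOf-injective {false} {false} _ = refl

signum-* : ∀ x y → signum (x ℤ.* y) ≡ signum x ℤ.* signum y
signum-* +0       y        = refl
signum-* +[1+ a ] +0       = cong signum (ℤₚ.*-zeroʳ +[1+ a ])
signum-* -[1+ a ] +0       = cong signum (ℤₚ.*-zeroʳ -[1+ a ])
signum-* +[1+ _ ] +[1+ _ ] = refl
signum-* +[1+ _ ] -[1+ _ ] = refl
signum-* -[1+ _ ] +[1+ _ ] = refl
signum-* -[1+ _ ] -[1+ _ ] = refl

signum-⊖ : ∀ m n → m ≢ n → signum (m ℤ.⊖ n) ≡ signOf (m <ᵇ n)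
signum-⊖ zero    zero    ne = contradiction refl ne
signum-⊖ zero    (suc n) ne = refl
signum-⊖ (suc m) zero    ne = refl
signum-⊖ (suc m) (suc n) ne = trans (cong signum (ℤₚ.[1+m]⊖[1+n]≡m⊖n m n)) (signum-⊖ m n (ne ∘ cong suc))

signum-label : ∀ {n} {i j : Fin n} → i ≢ j → signum (ℤ.+ label i ℤ.- ℤ.+ label j) ≡ signOf (toℕ i <ᵇ toℕ j)
signum-label {i = i} {j} i≢j = signum-⊖ (label i) (label j) (i≢j ∘ toℕ-injective ∘ suc-injective)

-- A difference of labels is negative exactly when the first label is smaller, so the product is
-- negative exactly when the two orders disagree.
linkingMatrix-off-diagonal : ∀ {n} .{{_ : NonZero n}} (σ : Permutation′ n) {i j} → i ≢ j →
  linkingMatrix σ i j ≡ signOf (inversion σ i j)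
linkingMatrix-off-diagonal σ {i} {j} i≢j = begin
  linkingMatrix σ i j
    ≡⟨ signum-* (ℤ.+ label i ℤ.- ℤ.+ label j) _ ⟩
  signum (ℤ.+ label i ℤ.- ℤ.+ label j) ℤ.* signum (ℤ.+ label (σ ⟨$⟩ʳ i) ℤ.- ℤ.+ label (σ ⟨$⟩ʳ j))
    ≡⟨ cong₂ ℤ._*_ (signum-label i≢j) (signum-label (i≢j ∘ ⟨$⟩ʳ-injective σ)) ⟩
  signOf (precedes id i j) ℤ.* signOf (precedes σ i j)
    ≡⟨ signOf-xor (precedes id i j) (precedes σ i j) ⟨
  signOf (inversion σ i j) ∎
  where open ≡-Reasoning

linkingMatrix-diagonal : ∀ {n} (σ : Permutation′ n) i → linkingMatrix σ i i ≡ 0ℤ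
linkingMatrix-diagonal σ i = cong (λ x → signum (x ℤ.* (ℤ.+ label (σ ⟨$⟩ʳ i) ℤ.- ℤ.+ label (σ ⟨$⟩ʳ i))))
  (ℤₚ.+-inverseʳ (ℤ.+ label i))

private
  ∑ : ∀ {n} → (Fin n → ℤ) → ℤ
  ∑ = sum ℤₚ.+-*-semiring

∑-cong : ∀ {n} {f g : Fin n → ℤ} → (∀ i → f i ≡ g i) → ∑ f ≡ ∑ g
∑-cong = sum-cong-≗ ℤₚ.+-*-semiring

∑-zero : ∀ n → ∑ {n} (λ _ → 0ℤ) ≡ 0ℤ
∑-zero = sum-replicate-zero ℤₚ.+-*-semiring

∑-select : ∀ {n} (f : Fin n → ℤ) j → ∑ (λ k → if does (k ≟ j) then f k else 0ℤ) ≡ f j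
∑-select {suc n} f zero    = trans (cong (ℤ._+_ (f zero)) (∑-zero n)) (ℤₚ.+-identityʳ (f zero))
∑-select f (suc j) = trans (ℤₚ.+-identityˡ _) (∑-select (f ∘ suc) j)

∑-selectʳ : ∀ {n} (f g : Fin n → ℤ) j → ∑ (λ k → f k ℤ.* (if does (k ≟ j) then g k else 0ℤ)) ≡ f j ℤ.* g j
∑-selectʳ f g j = trans (∑-cong push) (∑-select (λ k → f k ℤ.* g k) j)
  where
  push : ∀ k → f k ℤ.* (if does (k ≟ j) then g k else 0ℤ) ≡ (if does (k ≟ j) then f k ℤ.* g k else 0ℤ)
  push k with does (k ≟ j)
  ... | true  = refl
  ... | false = ℤₚ.*-zeroʳ (f k)

does-≟-sym : ∀ {n} (i j : Fin n) → does (i ≟ j) ≡ does (j ≟ i)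
does-≟-sym i j with i ≟ j | j ≟ i
... | yes _ | yes _ = refl
... | no  _ | no  _ = refl
... | yes e | no ne = contradiction (sym e) ne
... | no ne | yes e = contradiction (sym e) ne

∑-selectˡ : ∀ {n} (c : ℤ) (g : Fin n → ℤ) i → ∑ (λ k → (if does (i ≟ k) then c else 0ℤ) ℤ.* g k) ≡ c ℤ.* g i
∑-selectˡ c g i = trans (∑-cong push) (∑-select (λ k → c ℤ.* g k) i)
  where
  push : ∀ k → (if does (i ≟ k) then c else 0ℤ) ℤ.* g k ≡ (if does (k ≟ i) then c ℤ.* g k else 0ℤ)
  push k rewrite does-≟-sym i k with does (k ≟ i)
  ... | true  = refl
  ... | false = refl

-- Diagonal and permutation matrices have one nonzero candidate in each row and column, so every sum
-- in the product collapses to a single term.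
switched-matrix : ∀ {n} (X : Matrix n) (π : Permutation′ n) (d : Fin n → ℤ) i j →
  let P = permutationMatrix π
      D = diagonal d
  in (D · P ᵗ · X · P · D) i j ≡ d i ℤ.* X (π ⟨$⟩ʳ i) (π ⟨$⟩ʳ j) ℤ.* d j
switched-matrix X π d i j = begin
  (D · P ᵗ · X · P · D) i j                    ≡⟨ ∑-selectʳ ((D · P ᵗ · X · P) i) d j ⟩
  (D · P ᵗ · X · P) i j ℤ.* d j                ≡⟨ cong (ℤ._* d j) (∑-selectʳ ((D · P ᵗ · X) i) (λ _ → 1ℤ) (π ⟨$⟩ʳ j)) ⟩
  (D · P ᵗ · X) i (π ⟨$⟩ʳ j) ℤ.* 1ℤ ℤ.* d j    ≡⟨ cong (ℤ._* d j) (ℤₚ.*-identityʳ ((D · P ᵗ · X) i (π ⟨$⟩ʳ j))) ⟩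
  (D · P ᵗ · X) i (π ⟨$⟩ʳ j) ℤ.* d j           ≡⟨ cong (ℤ._* d j) (∑-cong λ k → cong (ℤ._* X k (π ⟨$⟩ʳ j)) (row k)) ⟩
  ∑ (λ k → (if does (π ⟨$⟩ʳ i ≟ k) then d i else 0ℤ) ℤ.* X k (π ⟨$⟩ʳ j)) ℤ.* d j
                                               ≡⟨ cong (ℤ._* d j) (∑-selectˡ (d i) (λ k → X k (π ⟨$⟩ʳ j)) (π ⟨$⟩ʳ i)) ⟩
  d i ℤ.* X (π ⟨$⟩ʳ i) (π ⟨$⟩ʳ j) ℤ.* d j      ∎
  where
  open ≡-Reasoning
  P = permutationMatrix π
  D = diagonal d
  row : ∀ k → (D · P ᵗ) i k ≡ (if does (π ⟨$⟩ʳ i ≟ k) then d i else 0ℤ)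
  row k = trans (∑-selectˡ (d i) (P k) i) scale
    where
    scale : d i ℤ.* P k i ≡ (if does (π ⟨$⟩ʳ i ≟ k) then d i else 0ℤ)
    scale rewrite does-≟-sym k (π ⟨$⟩ʳ i) with does (π ⟨$⟩ʳ i ≟ k)
    ... | true  = ℤₚ.*-identityʳ (d i)
    ... | false = ℤₚ.*-zeroʳ (d i)

module _ {n : ℕ} .{{_ : NonZero n}} {σ μ : Permutation′ n} where

  switched-sign : ∀ (π : Permutation′ n) (δ : Fin n → Bool) {i j} → i ≢ j →
    signOf (δ i) ℤ.* linkingMatrix σ (π ⟨$⟩ʳ i) (π ⟨$⟩ʳ j) ℤ.* signOf (δ j) ≡
    signOf (inversion σ (π ⟨$⟩ʳ i) (π ⟨$⟩ʳ j) xor (δ i xor δ j))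
  switched-sign π δ {i} {j} i≢j = begin
    signOf (δ i) ℤ.* linkingMatrix σ (π ⟨$⟩ʳ i) (π ⟨$⟩ʳ j) ℤ.* signOf (δ j)
      ≡⟨ cong (λ x → signOf (δ i) ℤ.* x ℤ.* signOf (δ j)) (linkingMatrix-off-diagonal σ (i≢j ∘ ⟨$⟩ʳ-injective π)) ⟩
    signOf (δ i) ℤ.* signOf e ℤ.* signOf (δ j)
      ≡⟨ cong (ℤ._* signOf (δ j)) (signOf-xor (δ i) e) ⟨
    signOf (δ i xor e) ℤ.* signOf (δ j)
      ≡⟨ signOf-xor (δ i xor e) (δ j) ⟨
    signOf ((δ i xor e) xor δ j)
      ≡⟨ cong signOf (trans (cong (_xor δ j) (Boolₚ.xor-comm (δ i) e)) (Boolₚ.xor-assoc e (δ i) (δ j))) ⟩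
    signOf (e xor (δ i xor δ j)) ∎
    where
    open ≡-Reasoning
    e = inversion σ (π ⟨$⟩ʳ i) (π ⟨$⟩ʳ j)

  switching⇒similar : SwitchingEquivalent (linkingMatrix σ) (linkingMatrix μ) → SimilarInversions σ μ
  switching⇒similar (π , d , ±1 , eq) = similar π (switched δ λ i j i≢j → signOf-injective (begin
      signOf (inversion μ i j)
        ≡⟨ linkingMatrix-off-diagonal μ i≢j ⟨
      linkingMatrix μ i j
        ≡⟨ trans (eq i j) (switched-matrix (linkingMatrix σ) π d i j) ⟩
      d i ℤ.* linkingMatrix σ (π ⟨$⟩ʳ i) (π ⟨$⟩ʳ j) ℤ.* d j
        ≡⟨ cong₂ (λ x y → x ℤ.* linkingMatrix σ (π ⟨$⟩ʳ i) (π ⟨$⟩ʳ j) ℤ.* y) (d≡ i) (d≡ j) ⟩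
      signOf (δ i) ℤ.* linkingMatrix σ (π ⟨$⟩ʳ i) (π ⟨$⟩ʳ j) ℤ.* signOf (δ j)
        ≡⟨ switched-sign π δ i≢j ⟩
      signOf (inversion σ (π ⟨$⟩ʳ i) (π ⟨$⟩ʳ j) xor (δ i xor δ j)) ∎))
    where
    open ≡-Reasoning
    δ : Fin n → Bool
    δ i = [ (λ _ → false) , (λ _ → true) ]′ (±1 i)
    d≡ : ∀ i → d i ≡ signOf (δ i)
    d≡ i with ±1 i
    ... | inj₁ e = e
    ... | inj₂ e = e

  similar⇒switching : SimilarInversions σ μ → SwitchingEquivalent (linkingMatrix σ) (linkingMatrix μ)
  similar⇒switching (similar π s) = π , signOf ∘ switch s , unit , λ i j →
      trans (entry i j) (sym (switched-matrix (linkingMatrix σ) π (signOf ∘ switch s) i j))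
    where
    unit : ∀ i → signOf (switch s i) ≡ 1ℤ ⊎ signOf (switch s i) ≡ -1ℤ
    unit i with switch s i
    ... | false = inj₁ refl
    ... | true  = inj₂ refl
    entry : ∀ i j → linkingMatrix μ i j ≡
      signOf (switch s i) ℤ.* linkingMatrix σ (π ⟨$⟩ʳ i) (π ⟨$⟩ʳ j) ℤ.* signOf (switch s j)
    entry i j with i ≟ j
    ... | no  i≢j = trans (linkingMatrix-off-diagonal μ i≢j)
          (trans (cong signOf (switches s i j i≢j)) (sym (switched-sign π (switch s) i≢j)))
    ... | yes refl = trans (linkingMatrix-diagonal μ i) (sym (cong (ℤ._* signOf (switch s i))
          (trans (cong (signOf (switch s i) ℤ.*_) (linkingMatrix-diagonal σ (π ⟨$⟩ʳ i)))
                 (ℤₚ.*-zeroʳ (signOf (switch s i))))))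

corollary1p2 : ∀ (n : ℕ) .{{_ : NonZero n}} (σ σ′ : Permutation′ n) →
    SwitchingEquivalent (linkingMatrix σ) (linkingMatrix σ′) ⇔ SpindleEquivalent σ σ′
corollary1p2 n σ σ′ = mk⇔
  (similar⇒equivalent ∘ switching⇒similar {σ = σ} {μ = σ′})
  (similar⇒switching {σ = σ} {μ = σ′} ∘ equivalent⇒similar)
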